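{- There is an algorithm which, given a tree-cograph $G$ on $n$ vertices together with a decomposition tree $T$ for $G$, computes the strong chromatic index $s\chi'(G)$ of $G$ in linear time.
   Context: Tree-cographs are defined recursively: (1) every tree is a tree-cograph; (2) if $G$ is a tree-cograph then its complement $\bar G$ is a tree-cograph; (3) for $k\ge 2$, if $G_1,\dots,G_k$ are connected tree-cographs then their disjoint union is a tree-cograph. A decomposition tree for a tree-cograph $G$ is a rooted binary tree in which each internal node (including the root) is labeled as a join node or a union node, each leaf is labeled by a tree or the complement of a tree, and $G$ is obtained by evaluating the tree: a union node yields the disjoint union of the graphs of its two children, and a join node yields the disjoint union of the graphs of its two children plus all edges between them. A strong edge coloring of a graph $G$ is a proper edge coloring such that no edge is adjacent to two edges of the same color; equivalently, a partition of $E(G)$ into induced matchings (sets of edges no two of which share an endpoint or are joined by an edge of $G$). The strong chromatic index $s\chi'(G)$ is the minimum number of colors in a strong edge coloring of $G$. -}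

module Defs where

open import Data.Empty using (⊥)
open import Data.Fin using (Fin; zero; suc; toℕ)
import Data.Fin.Properties as Fin
open import Data.List using (List; []; _∷_; _++_; _∷ʳ_; length; concatMap)
open import Data.List.Membership.Propositional using (_∈_)
open import Data.List.Relation.Unary.AllPairs using (AllPairs)
open import Data.List.Relation.Unary.Linked using (Linked)
open import Data.List.Relation.Unary.Unique.Propositional using (Unique)
open import Data.Nat using (ℕ; zero; suc; _+_; _*_; _∸_; _/_; _≤_; _<_; _≟_)
open import Data.Product using (Σ; _×_; _,_; proj₁)
open import Data.Sum using (_⊎_; inj₁; inj₂)
open import Data.Unit using (⊤; tt)
open import Data.Vec using (Vec; _∷_; lookup; replicate; _[_]≔_)
open import Data.Bool using (if_then_else_)
open import Function using (_↔_; _⇔_; Inverse)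
open import Level using (0ℓ)
open import Relation.Binary using (Rel; Symmetric; Irreflexive; Decidable)
open import Relation.Binary.Construct.Closure.ReflexiveTransitive using (Star)
open import Relation.Binary.PropositionalEquality using (_≡_; _≢_; refl; sym)
open import Relation.Nullary using (¬_; yes; no; does)
open import Relation.Nullary.Decidable using (_×-dec_; ¬?)

------------------------------------------------------------------------
-- Graphs

-- Simple graphs on a vertex type, which below is always finite.
record Graph (V : Set) : Set₁ where
  infix 4 _~_ _~?_
  field
    _~_      : Rel V 0ℓ
    _~?_     : Decidable _~_
    ~-sym    : Symmetric _~_
    ~-irrefl : Irreflexive _≡_ _~_

infix 4 _≅_

record _≅_ {V W : Set} (G : Graph V) (H : Graph W) : Set where
  private
    module G = Graph G
    module H = Graph H
  field
    bijection : V ↔ W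
    adjacency : ∀ u v → (u G.~ v) ⇔ (Inverse.to bijection u H.~ Inverse.to bijection v)

complement : ∀ {n} → Graph (Fin n) → Graph (Fin n)
complement {n} G = record
  { _~_      = λ u v → u ≢ v × ¬ (u ~ v)
  ; _~?_     = λ u v → ¬? (u Fin.≟ v) ×-dec ¬? (u ~? v)
  ; ~-sym    = λ (u≢v , u≁v) → (λ v≡u → u≢v (sym v≡u)) , (λ v~u → u≁v (~-sym v~u))
  ; ~-irrefl = λ u≡v (u≢v , _) → u≢v u≡v
  }
  where open Graph G

module _ {V W : Set} (G : Graph V) (H : Graph W) where
  private
    module G = Graph G
    module H = Graph H

  disjointUnion : Graph (V ⊎ W)
  disjointUnion = record
    { _~_ = adj ; _~?_ = adj? ; ~-sym = λ {x} {y} → adj-sym x y ; ~-irrefl = λ {x} → adj-irrefl x }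
    where
    adj : Rel (V ⊎ W) 0ℓ
    adj (inj₁ u) (inj₁ v) = u G.~ v
    adj (inj₁ _) (inj₂ _) = ⊥
    adj (inj₂ _) (inj₁ _) = ⊥
    adj (inj₂ u) (inj₂ v) = u H.~ v

    adj? : Decidable adj
    adj? (inj₁ u) (inj₁ v) = u G.~? v
    adj? (inj₁ _) (inj₂ _) = no λ ()
    adj? (inj₂ _) (inj₁ _) = no λ ()
    adj? (inj₂ u) (inj₂ v) = u H.~? v

    adj-sym : ∀ x y → adj x y → adj y x
    adj-sym (inj₁ u) (inj₁ v) = G.~-sym
    adj-sym (inj₂ u) (inj₂ v) = H.~-sym

    adj-irrefl : ∀ x {y} → x ≡ y → ¬ adj x y
    adj-irrefl (inj₁ u) refl = G.~-irrefl refl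
    adj-irrefl (inj₂ u) refl = H.~-irrefl refl

  joinGraph : Graph (V ⊎ W)
  joinGraph = record
    { _~_ = adj ; _~?_ = adj? ; ~-sym = λ {x} {y} → adj-sym x y ; ~-irrefl = λ {x} → adj-irrefl x }
    where
    adj : Rel (V ⊎ W) 0ℓ
    adj (inj₁ u) (inj₁ v) = u G.~ v
    adj (inj₁ _) (inj₂ _) = ⊤
    adj (inj₂ _) (inj₁ _) = ⊤
    adj (inj₂ u) (inj₂ v) = u H.~ v

    adj? : Decidable adj
    adj? (inj₁ u) (inj₁ v) = u G.~? v
    adj? (inj₁ _) (inj₂ _) = yes tt
    adj? (inj₂ _) (inj₁ _) = yes tt
    adj? (inj₂ u) (inj₂ v) = u H.~? v

    adj-sym : ∀ x y → adj x y → adj y x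
    adj-sym (inj₁ u) (inj₁ v) = G.~-sym
    adj-sym (inj₁ u) (inj₂ v) = λ _ → tt
    adj-sym (inj₂ u) (inj₁ v) = λ _ → tt
    adj-sym (inj₂ u) (inj₂ v) = H.~-sym

    adj-irrefl : ∀ x {y} → x ≡ y → ¬ adj x y
    adj-irrefl (inj₁ u) refl = G.~-irrefl refl
    adj-irrefl (inj₂ u) refl = H.~-irrefl refl

module _ {k : ℕ} {V : Fin k → Set} (G : ∀ i → Graph (V i)) where
  private
    module G i = Graph (G i)

  data Within : Rel (Σ (Fin k) V) 0ℓ where
    within : ∀ {i u v} → G._~_ i u v → Within (i , u) (i , v)

  disjointUnionOf : Graph (Σ (Fin k) V)
  disjointUnionOf = record
    { _~_      = Within
    ; _~?_     = within?
    ; ~-sym    = λ { (within {i} u~v) → within (G.~-sym i u~v) }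
    ; ~-irrefl = λ { refl (within {i} u~u) → G.~-irrefl i refl u~u }
    }
    where
    within? : Decidable Within
    within? (i , u) (j , v) with i Fin.≟ j
    ... | no i≢j = no λ { (within _) → i≢j refl }
    ... | yes refl with G._~?_ i u v
    ...   | yes u~v = yes (within u~v)
    ...   | no  u≁v = no λ { (within u~v) → u≁v u~v }

module _ {V : Set} (G : Graph V) where
  open Graph G

  -- The null graph does not count as connected.
  Connected : Set
  Connected = V × (∀ u v → Star _~_ u v)

  record Cycle : Set where
    field
      first      : V
      inner      : List V
      last       : V
      inner≢[]   : inner ≢ []
      path       : Linked _~_ (first ∷ inner ∷ʳ last)
      distinct   : Unique (first ∷ inner ∷ʳ last)
      last~first : last ~ first

  IsTree : Set
  IsTree = Connected × ¬ Cycle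

-- Complements and unions are taken up to isomorphism, so that the class
-- depends neither on vertex names nor on how adjacency is presented.
data TreeCograph : ∀ {n} → Graph (Fin n) → Set₁ where
  tree  : ∀ {n} {G : Graph (Fin n)} → IsTree G → TreeCograph G
  compl : ∀ {m n} {G : Graph (Fin m)} {H : Graph (Fin n)} →
          TreeCograph G → H ≅ complement G → TreeCograph H
  union : ∀ {k n} {size : Fin k → ℕ} {H : Graph (Fin n)} →
          2 ≤ k → (G : ∀ i → Graph (Fin (size i))) →
          (∀ i → Connected (G i)) → (∀ i → TreeCograph (G i)) →
          H ≅ disjointUnionOf G → TreeCograph H

------------------------------------------------------------------------
-- Decomposition trees

data DecompositionTree : Set₁ where
  treeLeaf   : ∀ {m} (G : Graph (Fin m)) → IsTree G → DecompositionTree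
  cotreeLeaf : ∀ {m} (G : Graph (Fin m)) → IsTree G → DecompositionTree
  unionNode  : DecompositionTree → DecompositionTree → DecompositionTree
  joinNode   : DecompositionTree → DecompositionTree → DecompositionTree

Vertex : DecompositionTree → Set
Vertex (treeLeaf {m} _ _)   = Fin m
Vertex (cotreeLeaf {m} _ _) = Fin m
Vertex (unionNode S T)      = Vertex S ⊎ Vertex T
Vertex (joinNode S T)       = Vertex S ⊎ Vertex T

⟦_⟧ : (T : DecompositionTree) → Graph (Vertex T)
⟦ treeLeaf G _ ⟧   = G
⟦ cotreeLeaf G _ ⟧ = complement G
⟦ unionNode S T ⟧  = disjointUnion ⟦ S ⟧ ⟦ T ⟧
⟦ joinNode S T ⟧   = joinGraph ⟦ S ⟧ ⟦ T ⟧

_IsDecompositionOf_ : ∀ {n} → DecompositionTree → Graph (Fin n) → Set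
T IsDecompositionOf G = G ≅ ⟦ T ⟧

------------------------------------------------------------------------
-- Strong edge colourings

-- Equality of unordered pairs.
SamePair : {V : Set} → Rel (V × V) 0ℓ
SamePair (u , v) (x , y) = (u ≡ x × v ≡ y) ⊎ (u ≡ y × v ≡ x)

Meet : {V : Set} → Rel (V × V) 0ℓ
Meet (u , v) (x , y) = (u ≡ x ⊎ u ≡ y) ⊎ (v ≡ x ⊎ v ≡ y)

module _ {V : Set} (G : Graph V) where
  open Graph G

  -- An oriented edge; SameEdge identifies the two orientations.
  Edge : Set
  Edge = Σ (V × V) λ (u , v) → u ~ v

  SameEdge : Rel Edge 0ℓ
  SameEdge e f = SamePair (proj₁ e) (proj₁ f)

  AdjacentEdges : Rel Edge 0ℓ
  AdjacentEdges e f = ¬ SameEdge e f × Meet (proj₁ e) (proj₁ f)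

  record StrongEdgeColouring (k : ℕ) : Set where
    field
      colour      : Edge → Fin k
      well-formed : ∀ e f → SameEdge e f → colour e ≡ colour f
      proper      : ∀ e f → AdjacentEdges e f → colour e ≢ colour f
      strong      : ∀ e f g → AdjacentEdges e f → AdjacentEdges e g →
                    ¬ SameEdge f g → colour f ≢ colour g

  IsStrongChromaticIndex : ℕ → Set
  IsStrongChromaticIndex s =
    StrongEdgeColouring s × (∀ k → StrongEdgeColouring k → s ≤ k)

------------------------------------------------------------------------
-- Random access machines

-- Structured programs over r registers and a random access memory. They
-- translate into jumping RAM code, each construct taking a constant
-- number of instructions.

data Op : Set where
  add sub mul div : Op

-- Subtraction is truncated, and division by zero yields zero.
apply : Op → ℕ → ℕ → ℕ
apply add x y       = x + y
apply sub x y       = x ∸ y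
apply mul x y       = x * y
apply div x zero    = zero
apply div x (suc y) = x / suc y

infix  20 _≔#_ _≔_⟨_⟩_ _≔mem[_] mem[_]≔_
infixr 10 _⨾_

data Program (r : ℕ) : Set where
  skip         : Program r
  _≔#_         : Fin r → ℕ → Program r
  _≔_⟨_⟩_      : Fin r → Fin r → Op → Fin r → Program r
  _≔mem[_]     : Fin r → Fin r → Program r
  mem[_]≔_     : Fin r → Fin r → Program r
  _⨾_          : Program r → Program r → Program r
  ifNonzero    : Fin r → Program r → Program r → Program r
  whileNonzero : Fin r → Program r → Program r

record State (r : ℕ) : Set where
  constructor ⟨_,_⟩
  field
    registers : Vec ℕ r
    memory    : ℕ → ℕ

_[_↦_] : (ℕ → ℕ) → ℕ → ℕ → (ℕ → ℕ)
(M [ a ↦ x ]) i = if does (i ≟ a) then x else M i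

-- W ⊢ P ∶ s ⇓[ t ] s′: started in s, the program P halts in s′ after t
-- steps. Every assignment and every test takes one step. Words range
-- over 0 … W ∸ 1; a program about to put a larger number into a register
-- gets stuck, so it has no result.
infix 4 _⊢_∶_⇓[_]_

data _⊢_∶_⇓[_]_ {r} (W : ℕ) : Program r → State r → ℕ → State r → Set where
  skip  : ∀ {s} → W ⊢ skip ∶ s ⇓[ 0 ] s
  const : ∀ {R M x c} → c < W →
          W ⊢ x ≔# c ∶ ⟨ R , M ⟩ ⇓[ 1 ] ⟨ R [ x ]≔ c , M ⟩
  op    : ∀ {R M x y o z} → let v = apply o (lookup R y) (lookup R z) in v < W →
          W ⊢ x ≔ y ⟨ o ⟩ z ∶ ⟨ R , M ⟩ ⇓[ 1 ] ⟨ R [ x ]≔ v , M ⟩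
  load  : ∀ {R M x a} → let v = M (lookup R a) in v < W →
          W ⊢ x ≔mem[ a ] ∶ ⟨ R , M ⟩ ⇓[ 1 ] ⟨ R [ x ]≔ v , M ⟩
  store : ∀ {R M a x} →
          W ⊢ mem[ a ]≔ x ∶ ⟨ R , M ⟩ ⇓[ 1 ] ⟨ R , M [ lookup R a ↦ lookup R x ] ⟩
  seq   : ∀ {P Q s s′ s″ t u} →
          W ⊢ P ∶ s ⇓[ t ] s′ → W ⊢ Q ∶ s′ ⇓[ u ] s″ →
          W ⊢ P ⨾ Q ∶ s ⇓[ t + u ] s″
  if-nonzero : ∀ {x P Q R M s′ t} → lookup R x ≢ 0 →
          W ⊢ P ∶ ⟨ R , M ⟩ ⇓[ t ] s′ →
          W ⊢ ifNonzero x P Q ∶ ⟨ R , M ⟩ ⇓[ suc t ] s′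
  if-zero : ∀ {x P Q R M s′ t} → lookup R x ≡ 0 →
          W ⊢ Q ∶ ⟨ R , M ⟩ ⇓[ t ] s′ →
          W ⊢ ifNonzero x P Q ∶ ⟨ R , M ⟩ ⇓[ suc t ] s′
  while-nonzero : ∀ {x P R M s′ s″ t u} → lookup R x ≢ 0 →
          W ⊢ P ∶ ⟨ R , M ⟩ ⇓[ t ] s′ →
          W ⊢ whileNonzero x P ∶ s′ ⇓[ u ] s″ →
          W ⊢ whileNonzero x P ∶ ⟨ R , M ⟩ ⇓[ suc (t + u) ] s″
  while-zero : ∀ {x P R M} → lookup R x ≡ 0 →
          W ⊢ whileNonzero x P ∶ ⟨ R , M ⟩ ⇓[ 1 ] ⟨ R , M ⟩

contents : List ℕ → ℕ → ℕ
contents []       _       = 0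
contents (w ∷ ws) zero    = w
contents (w ∷ ws) (suc i) = contents ws i

-- The input occupies memory cells 0 … length ws ∸ 1, its length is in
-- register 0, and everything else is zero.
initial : ∀ {r} → List ℕ → State (suc r)
initial {r} ws = ⟨ length ws ∷ replicate r 0 , contents ws ⟩

output : ∀ {r} → State (suc r) → ℕ
output s = lookup (State.registers s) zero

------------------------------------------------------------------------
-- Decomposition trees as input words

_ListsEdgesOf_ : ∀ {m} → List (Fin m × Fin m) → Graph (Fin m) → Set
es ListsEdgesOf G =
  (∀ u v → (u ~ v) ⇔ ((u , v) ∈ es ⊎ (v , u) ∈ es)) ×
  AllPairs (λ e f → ¬ SamePair e f) es
  where open Graph G

edgeWords : ∀ {m} → List (Fin m × Fin m) → List ℕ
edgeWords = concatMap λ (u , v) → toℕ u ∷ toℕ v ∷ []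

-- Postfix notation. A leaf is a tag, the number of vertices of its tree,
-- and the edges of that tree, each once, in any order and orientation;
-- for a complement leaf it is likewise the tree that is written down.
data _Encodes_ : List ℕ → DecompositionTree → Set₁ where
  treeLeaf   : ∀ {m} {G : Graph (Fin m)} {G-tree : IsTree G} {es} →
               es ListsEdgesOf G →
               (0 ∷ m ∷ edgeWords es) Encodes treeLeaf G G-tree
  cotreeLeaf : ∀ {m} {G : Graph (Fin m)} {G-tree : IsTree G} {es} →
               es ListsEdgesOf G →
               (1 ∷ m ∷ edgeWords es) Encodes cotreeLeaf G G-tree
  unionNode  : ∀ {S T ss ts} → ss Encodes S → ts Encodes T →
               (ss ++ ts ++ 2 ∷ []) Encodes unionNode S T
  joinNode   : ∀ {S T ss ts} → ss Encodes S → ts Encodes T →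
               (ss ++ ts ++ 3 ∷ []) Encodes joinNode S T

{-# OPTIONS --safe #-}

-- In a tree-cograph the strong chromatic index equals the largest number of
-- pairwise conflicting edges, where edges conflict if they meet or are joined
-- by an edge, and both numbers can be read off the decomposition tree.
--
-- In a tree the deg u + deg v − 1 edges meeting an edge uv conflict pairwise.
-- Conversely, colour the edges greedily by increasing depth: an edge uv with
-- upper end u conflicts only with those earlier edges that contain u or its
-- parent p, so as many colours as edges meet pu (or uv, if u is the root)
-- suffice. A tree has no 4-cycle, so in its complement all edges conflict, and
-- there are (m − 1)(m − 2)/2 of them. Edges in different parts of a disjoint
-- union never conflict. In a join an edge between the parts conflicts with
-- every edge, and so do edges in different parts with each other. Hence a union
-- node takes the maximum and a join node the sum plus the number of new edges.
--
-- A tree on m vertices has m − 1 edges, so the input has fewer than 3n words,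
-- and evaluating the postfix notation with a stack takes linear time.

module Submission where

open import Data.Bool using (true; false; if_then_else_)
open import Data.Empty using (⊥; ⊥-elim)
open import Data.Fin using (Fin; zero; suc; toℕ; fromℕ<; inject≤; combine)
open import Data.Fin.Patterns
open import Data.Fin.Permutation using (↔⇒≡)
import Data.Fin.Properties as Fin
open import Data.List using (List; []; _∷_; _++_; length; map; filter; allFin; cartesianProduct; lookup; _∷ʳ_)
open import Data.List.Membership.Propositional using (_∈_; _∉_)
open import Data.List.Membership.Propositional.Properties
open import Data.List.Membership.Propositional.Properties.WithK using (unique⇒irrelevant)
open import Data.List.Properties using (length-++; length-map; length-tabulate; filter-notAll; length-filter; ++-assoc; ++-identityʳ)
open import Data.List.Relation.Binary.Permutation.Propositional using (↭-sym)
open import Data.List.Relation.Binary.Permutation.Propositional.Properties using (∈-resp-↭)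
open import Data.List.Relation.Binary.Subset.Propositional using (_⊆_)
open import Data.List.Relation.Unary.All as All using (All; []; _∷_)
import Data.List.Relation.Unary.All.Properties as All
open import Data.List.Relation.Unary.AllPairs as AllPairs using (AllPairs; []; _∷_)
import Data.List.Relation.Unary.AllPairs.Properties as AllPairs
open import Data.List.Relation.Unary.Any as Any using (here; there; any?)
open import Data.List.Relation.Unary.Any.Properties using (lookup-index)
open import Data.List.Relation.Unary.Linked using (Linked; []; [-]; _∷_)
open import Data.List.Relation.Unary.Sorted.TotalOrder.Properties using (Sorted⇒AllPairs)
open import Data.List.Relation.Unary.Unique.Propositional using (Unique)
import Data.List.Relation.Unary.Unique.Propositional.Properties as Unique
import Data.List.Sort as Sort
open import Data.Nat using (ℕ; zero; suc; _+_; _*_; _∸_; _^_; _≤_; _<_; z≤n; s≤s; _⊔_; _/_; _≟_; >-nonZero; NonZero)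
open import Data.Nat.DivMod using (m*n/n≡m; m/n≤m)
import Data.Nat.Properties as ℕ
open import Data.Nat.Solver using (module +-*-Solver)
open import Data.Product using (Σ; ∃; ∃-syntax; _×_; _,_; proj₁; proj₂)
open import Data.Product.Function.NonDependent.Propositional using (_×-↔_)
open import Data.Sum using (_⊎_; inj₁; inj₂; [_,_]′)
import Data.Sum as Sum
open import Data.Sum.Function.Propositional using (_⊎-↔_)
import Data.Sum.Properties as Sum
open import Data.Unit using (tt)
open import Data.Vec as Vec using ([]; _∷_; Vec; _[_]≔_)
open import Defs
open import Function using (_∘_; _↔_; Inverse; Equivalence; Injective; mk⇔)
open import Function.Properties.Inverse using (↔-sym; ↔-trans; ↔-refl; ↔⇒↣)
open import Level using (0ℓ)
open import Relation.Binary as Binary using (Rel; DecidableEquality; DecTotalOrder)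
open import Relation.Binary.Construct.Closure.ReflexiveTransitive using (Star; ε; _◅_)
import Relation.Binary.Construct.Flip.EqAndOrd as Flip
import Relation.Binary.Construct.On as On
open import Relation.Binary.PropositionalEquality
open import Relation.Nullary using (¬_; Dec; yes; no; contradiction; does)
open import Relation.Nullary.Decidable using (_×-dec_; _⊎-dec_; ¬?; does-⇔; dec-true; dec-false; via-injection)

-- A strong edge colouring is constrained through triples of edges; the conflict relation replaces
-- these by pairs, so that colourings and cliques face each other directly. Pairing a colouring with
-- a clique of equal size means that no union or join has to analyse an arbitrary colouring.
--
-- A tree is given only as a connected graph without cycles. Its rooted structure has to be built:
-- depth is the length of a shortest walk from a root, and acyclicity shows that parents are unique
-- and that no edge stays within a level. Edges are then named by their lower ends, which lie in
-- `Fin m` and can be sorted and counted.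
--
-- The machine gets stuck on a word that is too large, so every intermediate value needs a bound,
-- not only the result. Addresses and counts stay within `4 * n`, everything else within its square.
-- Clearing degree counters is avoided by giving each leaf fresh cells, as many as it has vertices.

length-allFin : ∀ n → length (allFin n) ≡ n
length-allFin n = length-tabulate {n = n} (λ i → i)

-- Counting in finite lists

module _ {A : Set} where

  length-mono-⊆ : {xs ys : List A} → Unique xs → xs ⊆ ys → length xs ≤ length ys
  length-mono-⊆ [] _ = z≤n
  length-mono-⊆ {x ∷ xs} (x∉xs ∷ uniq) xs⊆ys with ∈-∃++ (xs⊆ys (here refl))
  ... | as , bs , refl = subst (suc (length xs) ≤_) (sym length-split)
                           (s≤s (length-mono-⊆ uniq xs⊆as++bs))
    where
    length-split : length (as ++ x ∷ bs) ≡ suc (length (as ++ bs))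
    length-split rewrite length-++ as {x ∷ bs} | length-++ as {bs} = ℕ.+-suc _ _

    xs⊆as++bs : xs ⊆ as ++ bs
    xs⊆as++bs {y} y∈xs with ∈-++⁻ as (xs⊆ys (there y∈xs))
    ... | inj₁ y∈as         = ∈-++⁺ˡ y∈as
    ... | inj₂ (here refl)  = contradiction y∈xs (All.All¬⇒¬Any x∉xs)
    ... | inj₂ (there y∈bs) = ∈-++⁺ʳ as y∈bs

  length-cartesianProduct : {B : Set} (xs : List A) (ys : List B) →
                            length (cartesianProduct xs ys) ≡ length xs * length ys
  length-cartesianProduct []       ys = refl
  length-cartesianProduct (x ∷ xs) ys =
    trans (length-++ (map (x ,_) ys))
          (cong₂ _+_ (length-map (x ,_) ys) (length-cartesianProduct xs ys))

unique-length : ∀ {n} {xs : List (Fin n)} → Unique xs → length xs ≤ n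
unique-length {n} {xs} uniq =
  subst (length xs ≤_) (length-allFin n) (length-mono-⊆ uniq (λ _ → ∈-allFin _))

complete-length : ∀ {n} {xs : List (Fin n)} → (∀ i → i ∈ xs) → n ≤ length xs
complete-length {n} {xs} all∈ =
  subst (_≤ length xs) (length-allFin n) (length-mono-⊆ (Unique.allFin⁺ n) (λ _ → all∈ _))

fresh : ∀ {k} (xs : List (Fin k)) → length xs < k → ∃[ c ] c ∉ xs
fresh {k} xs short =
  Fin.¬∀⟶∃¬ k (_∈ xs) (λ c → any? (c Fin.≟_) xs) λ all∈ → ℕ.<⇒≱ short (complete-length all∈)

to-injective : {A B : Set} (A↔B : A ↔ B) → Injective _≡_ _≡_ (Inverse.to A↔B)
to-injective A↔B eq = trans (sym (strictlyInverseʳ _)) (trans (cong from eq) (strictlyInverseʳ _))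
  where open Inverse A↔B

from-injective : {A B : Set} (A↔B : A ↔ B) → Injective _≡_ _≡_ (Inverse.from A↔B)
from-injective A↔B = to-injective (↔-sym A↔B)

-- Conflicting edges

module _ {V : Set} where

  samePair-sym : {p q : V × V} → SamePair p q → SamePair q p
  samePair-sym (inj₁ (refl , refl)) = inj₁ (refl , refl)
  samePair-sym (inj₂ (refl , refl)) = inj₂ (refl , refl)

  samePair-trans : {p q r : V × V} → SamePair p q → SamePair q r → SamePair p r
  samePair-trans (inj₁ (refl , refl)) s = s
  samePair-trans (inj₂ (refl , refl)) (inj₁ (refl , refl)) = inj₂ (refl , refl)
  samePair-trans (inj₂ (refl , refl)) (inj₂ (refl , refl)) = inj₁ (refl , refl)

  samePair? : DecidableEquality V → (p q : V × V) → Dec (SamePair p q)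
  samePair? _≟_ (u , v) (x , y) =
    ((u ≟ x) ×-dec (v ≟ y)) ⊎-dec ((u ≟ y) ×-dec (v ≟ x))

samePair-map : {V W : Set} (f : V → W) {p q : V × V} → SamePair p q →
               SamePair (f (proj₁ p) , f (proj₂ p)) (f (proj₁ q) , f (proj₂ q))
samePair-map f (inj₁ (refl , refl)) = inj₁ (refl , refl)
samePair-map f (inj₂ (refl , refl)) = inj₂ (refl , refl)

samePair-injective : {V W : Set} {f : V → W} → Injective _≡_ _≡_ f → {p q : V × V} →
                     SamePair (f (proj₁ p) , f (proj₂ p)) (f (proj₁ q) , f (proj₂ q)) →
                     SamePair p q
samePair-injective inj = Sum.map (λ (a , b) → inj a , inj b) (λ (a , b) → inj a , inj b)

meet-map : {V W : Set} (f : V → W) {p q : V × V} → Meet p q →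
           Meet (f (proj₁ p) , f (proj₂ p)) (f (proj₁ q) , f (proj₂ q))
meet-map f = Sum.map (Sum.map (cong f) (cong f)) (Sum.map (cong f) (cong f))

module _ {V : Set} (G : Graph V) where
  open Graph G

  Near : Rel V 0ℓ
  Near u v = u ≡ v ⊎ u ~ v

  near-sym : ∀ {u v} → Near u v → Near v u
  near-sym = Sum.map sym ~-sym

  Close : Rel (V × V) 0ℓ
  Close (u , v) (x , y) = (Near u x ⊎ Near u y) ⊎ (Near v x ⊎ Near v y)

  Conflict : Rel (Edge G) 0ℓ
  Conflict e f = ¬ SameEdge G e f × Close (proj₁ e) (proj₁ f)

  Clique : List (Edge G) → Set
  Clique = AllPairs Conflict

  -- The colours form an arbitrary type, so that a join can be coloured by a sum type and renamed to
  -- `Fin` afterwards with `recolour`.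
  record ConflictColouring (C : Set) : Set where
    field
      colour      : Edge G → C
      well-formed : ∀ e f → SameEdge G e f → colour e ≡ colour f
      separates   : ∀ e f → Conflict e f → colour e ≢ colour f

  -- An optimal colouring witnessed by a clique of the same size: in a
  -- tree-cograph the clique number of the conflict graph is always attained.
  record Certificate (s : ℕ) : Set where
    field
      colouring : ConflictColouring (Fin s)
      clique    : List (Edge G)
      isClique  : Clique clique
      size      : length clique ≡ s

  close-sym : ∀ {p q} → Close p q → Close q p
  close-sym (inj₁ (inj₁ n)) = inj₁ (inj₁ (near-sym n))
  close-sym (inj₁ (inj₂ n)) = inj₂ (inj₁ (near-sym n))
  close-sym (inj₂ (inj₁ n)) = inj₁ (inj₂ (near-sym n))
  close-sym (inj₂ (inj₂ n)) = inj₂ (inj₂ (near-sym n))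

  meet⇒close : ∀ {p q} → Meet p q → Close p q
  meet⇒close = Sum.map (Sum.map inj₁ inj₁) (Sum.map inj₁ inj₁)

  private
    meets-meets : ∀ {u v} {p q : V × V} → u ~ v → u ≡ proj₁ p ⊎ u ≡ proj₂ p →
                  Meet (u , v) q → Close p q
    meets-meets _   (inj₁ refl) (inj₁ m) = inj₁ (Sum.map inj₁ inj₁ m)
    meets-meets _   (inj₂ refl) (inj₁ m) = inj₂ (Sum.map inj₁ inj₁ m)
    meets-meets u~v (inj₁ refl) (inj₂ m) = inj₁ (Sum.map (λ { refl → inj₂ u~v }) (λ { refl → inj₂ u~v }) m)
    meets-meets u~v (inj₂ refl) (inj₂ m) = inj₂ (Sum.map (λ { refl → inj₂ u~v }) (λ { refl → inj₂ u~v }) m)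

  -- Edges meeting `e` either share an end of it or contain different ends of it, and then `e`
  -- itself joins them. This serves twice: it makes conflict colourings strong, and it makes the
  -- edges that meet a tree edge a clique.
  adjacent-adjacent⇒close : (e f g : Edge G) → Meet (proj₁ e) (proj₁ f) → Meet (proj₁ e) (proj₁ g) →
                            Close (proj₁ f) (proj₁ g)
  adjacent-adjacent⇒close (_ , u~v) f g (inj₁ m) m′ = meets-meets u~v m m′
  adjacent-adjacent⇒close (_ , u~v) f g (inj₂ m) m′ = meets-meets (~-sym u~v) m (Sum.swap m′)

  toStrong : ∀ {k} → ConflictColouring (Fin k) → StrongEdgeColouring G k
  toStrong c = record
    { colour      = colour
    ; well-formed = well-formed
    ; proper      = λ e f (e≁f , m) → separates e f (e≁f , meet⇒close {proj₁ e} m)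
    ; strong      = λ e f g (_ , m) (_ , m′) f≁g →
                    separates f g (f≁g , adjacent-adjacent⇒close e f g m m′)
    }
    where open ConflictColouring c

  module _ (_≟_ : DecidableEquality V) {k} (c : StrongEdgeColouring G k) where
    open StrongEdgeColouring c

    private
      meet? : ∀ p q → Dec (Meet p q)
      meet? (u , v) (x , y) = ((u ≟ x) ⊎-dec (u ≟ y)) ⊎-dec ((v ≟ x) ⊎-dec (v ≟ y))

      same⇒meet : ∀ {p q r : V × V} → SamePair p q → Meet p r → Meet q r
      same⇒meet (inj₁ (refl , refl)) m = m
      same⇒meet (inj₂ (refl , refl)) m = Sum.swap m

      meet-sym : ∀ {p q : V × V} → Meet p q → Meet q p
      meet-sym (inj₁ (inj₁ n)) = inj₁ (inj₁ (sym n))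
      meet-sym (inj₁ (inj₂ n)) = inj₂ (inj₁ (sym n))
      meet-sym (inj₂ (inj₁ n)) = inj₁ (inj₂ (sym n))
      meet-sym (inj₂ (inj₂ n)) = inj₂ (inj₂ (sym n))

      -- Edges joined by g are adjacent to g, unless they already meet.
      bridge : ∀ e f g → ¬ SameEdge G e f →
               Meet (proj₁ g) (proj₁ e) → Meet (proj₁ g) (proj₁ f) → colour e ≢ colour f
      bridge e f g e≁f m m′ with meet? (proj₁ e) (proj₁ f)
      ... | yes meet = proper e f (e≁f , meet)
      ... | no ¬meet = strong g e f
        ((λ s → ¬meet (same⇒meet s m′)) , m)
        ((λ s → ¬meet (meet-sym {proj₁ f} (same⇒meet s m))) , m′)
        e≁f

    -- Coinciding ends fall under `proper`; for adjacent ends, the edge between them is the middle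
    -- edge that `bridge` asks for.
    strong-separates : ∀ e f → Conflict e f → colour e ≢ colour f
    strong-separates e f (e≁f , inj₁ (inj₁ (inj₁ x))) = proper e f (e≁f , inj₁ (inj₁ x))
    strong-separates e f (e≁f , inj₁ (inj₂ (inj₁ x))) = proper e f (e≁f , inj₁ (inj₂ x))
    strong-separates e f (e≁f , inj₂ (inj₁ (inj₁ x))) = proper e f (e≁f , inj₂ (inj₁ x))
    strong-separates e f (e≁f , inj₂ (inj₂ (inj₁ x))) = proper e f (e≁f , inj₂ (inj₂ x))
    strong-separates e f (e≁f , inj₁ (inj₁ (inj₂ a))) = bridge e f (_ , a) e≁f (inj₁ (inj₁ refl)) (inj₂ (inj₁ refl))
    strong-separates e f (e≁f , inj₁ (inj₂ (inj₂ a))) = bridge e f (_ , a) e≁f (inj₁ (inj₁ refl)) (inj₂ (inj₂ refl))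
    strong-separates e f (e≁f , inj₂ (inj₁ (inj₂ a))) = bridge e f (_ , a) e≁f (inj₁ (inj₂ refl)) (inj₂ (inj₁ refl))
    strong-separates e f (e≁f , inj₂ (inj₂ (inj₂ a))) = bridge e f (_ , a) e≁f (inj₁ (inj₂ refl)) (inj₂ (inj₂ refl))

    clique-bound : ∀ {es} → Clique es → length es ≤ k
    clique-bound {es} cl = subst (_≤ k) (length-map colour es)
      (unique-length (AllPairs.map⁺ (AllPairs.map (λ {e} {f} → strong-separates e f) cl)))

  certificate⇒index : DecidableEquality V → ∀ {s} → Certificate s → IsStrongChromaticIndex G s
  certificate⇒index _≟_ cert =
    toStrong colouring , λ k c → subst (_≤ k) size (clique-bound _≟_ c isClique)
    where open Certificate cert

  recolour : {C D : Set} (f : C → D) → Injective _≡_ _≡_ f → ConflictColouring C → ConflictColouring D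
  recolour f inj c = record
    { colour      = f ∘ colour
    ; well-formed = λ e e′ s → cong f (well-formed e e′ s)
    ; separates   = λ e e′ x eq → separates e e′ x (inj eq)
    }
    where open ConflictColouring c

-- Transport along isomorphisms

module _ {V W : Set} {G : Graph V} {H : Graph W} where
  private
    module G = Graph G
    module H = Graph H

  -- An injective homomorphism is enough: adjacency of edges only concerns shared ends, so every
  -- constraint in `G` is the image of one in `H`, and further edges of `H` do no harm.
  pullback : (f : V → W) → Injective _≡_ _≡_ f → (∀ {u v} → u G.~ v → f u H.~ f v) →
             ∀ {k} → StrongEdgeColouring H k → StrongEdgeColouring G k
  pullback f inj hom c = record
    { colour      = colour ∘ push
    ; well-formed = λ e e′ s → well-formed _ _ (samePair-map f s)
    ; proper      = λ e e′ a → proper _ _ (adj e e′ a)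
    ; strong      = λ e e′ e″ a a′ d → strong (push e) (push e′) (push e″)
                    (adj e e′ a) (adj e e″ a′) (d ∘ samePair-injective inj)
    }
    where
    open StrongEdgeColouring c

    push : Edge G → Edge H
    push ((u , v) , u~v) = (f u , f v) , hom u~v

    adj : ∀ e e′ → AdjacentEdges G e e′ → AdjacentEdges H (push e) (push e′)
    adj e e′ (d , m) = d ∘ samePair-injective inj , meet-map f {proj₁ e} {proj₁ e′} m

module _ {V W : Set} {G : Graph V} {H : Graph W} where
  private
    module G = Graph G
    module H = Graph H

  index-respects-≅ : G ≅ H → ∀ {s} → IsStrongChromaticIndex H s → IsStrongChromaticIndex G s
  index-respects-≅ iso (c , least) =
    pullback to (to-injective bijection) (λ {u} {v} → Equivalence.to (adjacency u v)) c ,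
    λ k c′ → least k (pullback from (from-injective bijection) from-hom c′)
    where
    open _≅_ iso
    open Inverse bijection using (to; from; strictlyInverseˡ)

    from-hom : ∀ {u v} → u H.~ v → from u G.~ from v
    from-hom {u} {v} u~v = Equivalence.from (adjacency _ _)
      (subst₂ H._~_ (sym (strictlyInverseˡ u)) (sym (strictlyInverseˡ v)) u~v)

-- Greedy colouring by rank

module _ {n k : ℕ} (d : Fin n → ℕ) (R : Rel (Fin n) 0ℓ) (R-sym : ∀ {x y} → R x y → R y x)
         (R-irrefl : ∀ {x} → ¬ R x x)
         (forbidden : Fin n → List (Fin n)) (few : ∀ x → length (forbidden x) < k)
         (covered : ∀ {x y} → R x y → d y ≤ d x → y ∈ forbidden x) where

  private
    byRank : DecTotalOrder 0ℓ 0ℓ 0ℓ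
    byRank = On.decTotalOrder (Flip.decTotalOrder ℕ.≤-decTotalOrder) d

    open Sort byRank using (sort; sort-↭; sort-↗)

    Proper : List (Fin n) → (Fin n → Fin k) → Set
    Proper xs c = ∀ {x y} → x ∈ xs → y ∈ xs → R x y → c x ≢ c y

    -- The head is coloured last, so it must be the element of largest rank.
    colour-list : Fin k → ∀ xs → AllPairs (λ x y → d y ≤ d x) xs → ∃ (Proper xs)
    -- Elements outside the list need some colour too; `c₀` is the default.
    colour-list c₀ [] _ = (λ _ → c₀) , λ ()
    colour-list c₀ (x ∷ xs) (top ∷ sorted)
      with c , proper ← colour-list c₀ xs sorted
      with new , new∉ ← fresh (map c (forbidden x)) (subst (_< k) (sym (length-map c (forbidden x))) (few x))
      = c′ , proper′
      where
      c′ : Fin n → Fin k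
      c′ y = if does (y Fin.≟ x) then new else c y

      clash : ∀ {y} → y ∈ xs → R x y → new ≢ c y
      clash y∈ r refl = new∉ (∈-map⁺ c (covered r (All.lookup top y∈)))

      proper′ : Proper (x ∷ xs) c′
      proper′ {y} {z} y∈ z∈ r eq with y Fin.≟ x | z Fin.≟ x
      ... | yes refl | yes refl = R-irrefl r
      ... | yes refl | no z≢x   = clash (Any.tail z≢x z∈) r eq
      ... | no y≢x   | yes refl = clash (Any.tail y≢x y∈) (R-sym r) (sym eq)
      ... | no y≢x   | no z≢x   = proper (Any.tail y≢x y∈) (Any.tail z≢x z∈) r eq

  -- When an element gets its colour, those already coloured have no larger rank, so the related
  -- ones lie in its forbidden list, which is too short to use up all colours. Elements of equal
  -- rank come in an unknown order, hence the weak inequality in `covered`.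
  greedy : Fin k → ∃[ c ] (∀ {x y} → R x y → c x ≢ c y)
  greedy c₀ with colour-list c₀ (sort (allFin n))
                   (Sorted⇒AllPairs (DecTotalOrder.totalOrder byRank) (sort-↗ (allFin n)))
  ... | c , proper = c , λ r → proper (everywhere _) (everywhere _) r
    where
    everywhere : ∀ x → x ∈ sort (allFin n)
    everywhere x = ∈-resp-↭ (↭-sym (sort-↭ (allFin n))) (∈-allFin x)

-- Trees

least : {P : ℕ → Set} → (∀ k → Dec (P k)) → ∀ k → P k → ∃[ j ] P j × (∀ i → P i → j ≤ i)
least P? zero    p = zero , p , λ _ _ → z≤n
least P? (suc k) p with P? zero
... | yes p₀ = zero , p₀ , λ _ _ → z≤n
... | no ¬p₀ with j , q , min ← least (P? ∘ suc) k p =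
  suc j , q , λ { zero p₀ → contradiction p₀ ¬p₀ ; (suc i) pᵢ → s≤s (min i pᵢ) }

module Tree {m} (G : Graph (Fin m)) (G-tree : IsTree G) where
  open Graph G

  private
    V = Fin m

  root : V
  root = proj₁ (proj₁ G-tree)

  -- Indexing by the length makes walks decidable by a search over the last step, which lets `least`
  -- find a shortest one.
  Walk : ℕ → V → Set
  Walk zero    v = root ≡ v
  Walk (suc k) v = ∃[ u ] (u ~ v × Walk k u)

  walk? : ∀ k v → Dec (Walk k v)
  walk? zero    v = root Fin.≟ v
  walk? (suc k) v = Fin.any? λ u → (u ~? v) ×-dec walk? k u

  extend : ∀ {k u v} → Walk k u → Star _~_ u v → ∃[ j ] Walk j v
  extend w ε         = _ , w
  extend w (u~x ◅ s) = extend (_ , u~x , w) s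

  private
    shortest : ∀ v → ∃[ k ] Walk k v × (∀ j → Walk j v → k ≤ j)
    shortest v with k , w ← extend {zero} refl (proj₂ (proj₁ G-tree) root v) =
      least (λ k → walk? k v) k w

  depth : V → ℕ
  depth v = proj₁ (shortest v)

  depth-minimal : ∀ {k v} → Walk k v → depth v ≤ k
  depth-minimal {k} {v} = proj₂ (proj₂ (shortest v)) k

  depth-step : ∀ {u v} → u ~ v → depth v ≤ suc (depth u)
  depth-step {u} u~v = depth-minimal (u , u~v , proj₁ (proj₂ (shortest u)))

  depth≡0⇒root : ∀ {v} → depth v ≡ 0 → root ≡ v
  depth≡0⇒root {v} eq with shortest v
  depth≡0⇒root refl | zero , w , _ = w

  depth-root : depth root ≡ 0
  depth-root = ℕ.n≤0⇒n≡0 (depth-minimal refl)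

  -- The last vertex before `v` on a shortest walk: the rest of the walk bounds its depth from
  -- above, and `depth-step` from below.
  parent-exists : ∀ {v k} → depth v ≡ suc k → ∃[ u ] u ~ v × depth u ≡ k
  parent-exists {v} eq with shortest v in dist
  parent-exists {v} refl | suc k , (u , u~v , w) , min = u , u~v ,
    ℕ.≤-antisym (depth-minimal w) (ℕ.≤-pred (subst (λ s → proj₁ s ≤ suc (depth u)) dist (depth-step u~v)))

  private
    linked-snoc : ∀ {x} xs {y z} → Linked _~_ (x ∷ xs ∷ʳ y) → y ~ z → Linked _~_ (x ∷ (xs ∷ʳ y) ∷ʳ z)
    linked-snoc []       (x~y ∷ _) y~z = x~y ∷ y~z ∷ [-]
    linked-snoc (_ ∷ xs) (x~w ∷ l) y~z = x~w ∷ linked-snoc xs l y~z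

    snoc≢[] : ∀ (xs : List V) {y} → xs ∷ʳ y ≢ []
    snoc≢[] []      ()
    snoc≢[] (_ ∷ _) ()

  -- Two vertices of one level are joined by a path through lower levels, so
  -- neither an edge nor a second common neighbour above can join them again.
  record LowPath (k : ℕ) (a b : V) : Set where
    field
      inner    : List V
      inner≢[] : inner ≢ []
      path     : Linked _~_ (a ∷ inner ∷ʳ b)
      distinct : Unique (a ∷ inner ∷ʳ b)
      low      : All (λ x → depth x < k) inner

  -- Both ends step to their parents until these coincide, at the latest in the root. Distinctness
  -- comes from depth alone, since everything in between lies strictly above the two ends.
  low-path : ∀ k {a b} → depth a ≡ k → depth b ≡ k → a ≢ b → LowPath k a b
  low-path zero    da db a≢b =
    contradiction (trans (sym (depth≡0⇒root da)) (depth≡0⇒root db)) a≢b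
  low-path (suc k) {a} {b} da db a≢b
    with p , p~a , dp ← parent-exists da
    with q , q~b , dq ← parent-exists db
    with p Fin.≟ q
  ... | yes refl = record
    { inner    = p ∷ []
    ; inner≢[] = λ ()
    ; path     = ~-sym p~a ∷ q~b ∷ [-]
    ; distinct = ((λ { refl → ~-irrefl refl p~a }) ∷ a≢b ∷ [])
               ∷ ((λ { refl → ~-irrefl refl q~b }) ∷ []) ∷ [] ∷ []
    ; low      = s≤s (ℕ.≤-reflexive dp) ∷ []
    }
  ... | no p≢q = record
    { inner    = p ∷ inner ∷ʳ q
    ; inner≢[] = λ ()
    ; path     = ~-sym p~a ∷ linked-snoc inner path q~b
    ; distinct = All.∷ʳ⁺ (All.map (different da) below) a≢b
               ∷ AllPairs.++⁺ distinct ([] ∷ []) (All.map (λ lt → (λ eq → different db lt (sym eq)) ∷ []) below)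
    ; low      = below
    }
    where
    open LowPath (low-path k dp dq p≢q)

    below : All (λ x → depth x < suc k) (p ∷ inner ∷ʳ q)
    below = s≤s (ℕ.≤-reflexive dp)
          ∷ All.∷ʳ⁺ (All.map (λ lt → ℕ.m≤n⇒m≤1+n lt) low) (s≤s (ℕ.≤-reflexive dq))

    different : ∀ {x y} → depth x ≡ suc k → depth y < suc k → x ≢ y
    different dx lt refl = ℕ.<⇒≢ lt dx

  level-edge-free : ∀ {u v} → u ~ v → depth u ≢ depth v
  level-edge-free {u} {v} u~v eq = proj₂ G-tree record
    { first = u ; inner = inner ; last = v ; inner≢[] = inner≢[]
    ; path = path ; distinct = distinct ; last~first = ~-sym u~v }
    where open LowPath (low-path (depth u) refl (sym eq) (λ u≡v → ~-irrefl u≡v u~v))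

  parent-unique : ∀ {a b c} → a ~ c → b ~ c → depth c ≡ suc (depth a) → depth c ≡ suc (depth b) → a ≡ b
  parent-unique {a} {b} {c} a~c b~c da db with a Fin.≟ b
  ... | yes a≡b = a≡b
  ... | no a≢b = ⊥-elim (proj₂ G-tree record
    { first = c ; inner = a ∷ inner ; last = b ; inner≢[] = λ ()
    ; path = ~-sym a~c ∷ path
    ; distinct = All.map (λ { le refl → ℕ.<⇒≱ (ℕ.≤-reflexive (sym da)) le })
                   (ℕ.≤-refl ∷ All.∷ʳ⁺ (All.map ℕ.<⇒≤ low) (ℕ.≤-reflexive same))
               ∷ distinct
    ; last~first = b~c })
    where
    same : depth b ≡ depth a
    same = ℕ.suc-injective (trans (sym db) da)
    open LowPath (low-path (depth a) refl same a≢b)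

  private
    -- The depth is a separate argument so that it can be matched on. The value at depth zero is a
    -- filler, which `parent-spec` excludes.
    parentAt : ∀ v k → depth v ≡ k → V
    parentAt v zero    _  = v
    parentAt v (suc k) eq = proj₁ (parent-exists eq)

  parent : V → V
  parent v = parentAt v (depth v) refl

  infix 4 _isParentOf_
  _isParentOf_ : Rel V 0ℓ
  u isParentOf v = u ~ v × depth v ≡ suc (depth u)

  parent-spec : ∀ {v} → v ≢ root → parent v isParentOf v
  parent-spec {v} v≢root = at (depth v) refl
    where
    at : ∀ k (eq : depth v ≡ k) → parentAt v k eq isParentOf v
    at zero    eq = contradiction (sym (depth≡0⇒root eq)) v≢root
    at (suc k) eq with u , u~v , du ← parent-exists eq = u~v , trans eq (cong suc (sym du))

  isParentOf⇒≢root : ∀ {u v} → u isParentOf v → v ≢ root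
  isParentOf⇒≢root (_ , eq) refl with () ← trans (sym depth-root) eq

  isParentOf⇒parent : ∀ {u v} → u isParentOf v → parent v ≡ u
  isParentOf⇒parent p@(u~v , eq) with p~v , eq′ ← parent-spec (isParentOf⇒≢root p) =
    parent-unique p~v u~v eq′ eq

  -- Depths along an edge differ by at most one by `depth-step`, and not by zero by
  -- `level-edge-free`.
  orient : ∀ {u v} → u ~ v → u isParentOf v ⊎ v isParentOf u
  orient {u} {v} u~v with ℕ.<-cmp (depth u) (depth v)
  ... | Binary.tri< lt _ _ = inj₁ (u~v , ℕ.≤-antisym (depth-step u~v) lt)
  ... | Binary.tri≈ _ eq _ = contradiction eq (level-edge-free u~v)
  ... | Binary.tri> _ _ gt = inj₂ (~-sym u~v , ℕ.≤-antisym (depth-step (~-sym u~v)) gt)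

  -- Sending an edge to its lower end identifies the edges with the vertices other than the root.
  child : Edge G → V
  child ((u , v) , u~v) = [ (λ _ → v) , (λ _ → u) ]′ (orient u~v)

  child≢root : ∀ e → child e ≢ root
  child≢root ((u , v) , u~v) with orient u~v
  ... | inj₁ p = isParentOf⇒≢root p
  ... | inj₂ p = isParentOf⇒≢root p

  parentEdge : V → V × V
  parentEdge v = parent v , v

  parentEdge-child : ∀ e → SamePair (proj₁ e) (parentEdge (child e))
  parentEdge-child ((u , v) , u~v) with orient u~v
  ... | inj₁ p = inj₁ (sym (isParentOf⇒parent p) , refl)
  ... | inj₂ p = inj₂ (refl , sym (isParentOf⇒parent p))

  child-unique : ∀ e {v} → v ≢ root → SamePair (proj₁ e) (parentEdge v) → child e ≡ v
  child-unique ((u , v) , u~v) w≢root s with orient u~v | s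
  ... | inj₁ p | inj₁ (refl , refl) = refl
  ... | inj₂ p | inj₂ (refl , refl) = refl
  -- The vertex would be the parent of its own parent, and its depth would exceed itself by two.
  ... | inj₁ (_ , eq) | inj₂ (refl , refl) =
    contradiction (trans (proj₂ (parent-spec w≢root)) (cong suc eq)) (ℕ.<⇒≢ (ℕ.m≤n⇒m≤1+n ℕ.≤-refl))
  ... | inj₂ (_ , eq) | inj₁ (refl , refl) =
    contradiction (trans (proj₂ (parent-spec w≢root)) (cong suc eq)) (ℕ.<⇒≢ (ℕ.m≤n⇒m≤1+n ℕ.≤-refl))

  same⇒child≡ : ∀ e f → SameEdge G e f → child e ≡ child f
  same⇒child≡ e f s = child-unique e (child≢root f) (samePair-trans s (parentEdge-child f))

  child≡⇒same : ∀ e f → child e ≡ child f → SameEdge G e f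
  child≡⇒same e f eq = samePair-trans (parentEdge-child e)
    (samePair-sym (subst (λ c → SamePair (proj₁ f) (parentEdge c)) (sym eq) (parentEdge-child f)))

-- Disjoint unions and joins

module _ {V W : Set} (G : Graph V) (H : Graph W) where
  private
    module G = Graph G
    module H = Graph H
    G∪H = disjointUnion G H
    G+H = joinGraph G H

  module _ {s t : ℕ} (c : ConflictColouring G (Fin s)) (d : ConflictColouring H (Fin t)) where
    private
      module c = ConflictColouring c
      module d = ConflictColouring d

    union-colouring : ConflictColouring G∪H (Fin (s ⊔ t))
    union-colouring = record { colour = col ; well-formed = wf ; separates = sep }
      where
      s≤ = ℕ.m≤m⊔n s t
      t≤ = ℕ.m≤n⊔m s t

      col : Edge G∪H → Fin (s ⊔ t)
      col ((inj₁ u , inj₁ v) , a) = inject≤ (c.colour ((u , v) , a)) s≤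
      col ((inj₂ u , inj₂ v) , a) = inject≤ (d.colour ((u , v) , a)) t≤

      wf : ∀ e f → SameEdge G∪H e f → col e ≡ col f
      wf ((inj₁ u , inj₁ v) , a) ((inj₁ x , inj₁ y) , b) s =
        cong (λ i → inject≤ i s≤) (c.well-formed _ _ (samePair-injective Sum.inj₁-injective s))
      wf ((inj₂ u , inj₂ v) , a) ((inj₂ x , inj₂ y) , b) s =
        cong (λ i → inject≤ i t≤) (d.well-formed _ _ (samePair-injective Sum.inj₂-injective s))
      wf ((inj₁ _ , inj₁ _) , _) ((inj₂ _ , inj₂ _) , _) (inj₁ (() , _))
      wf ((inj₁ _ , inj₁ _) , _) ((inj₂ _ , inj₂ _) , _) (inj₂ (() , _))
      wf ((inj₂ _ , inj₂ _) , _) ((inj₁ _ , inj₁ _) , _) (inj₁ (() , _))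
      wf ((inj₂ _ , inj₂ _) , _) ((inj₁ _ , inj₁ _) , _) (inj₂ (() , _))

      near₁ : ∀ {u v} → Near G∪H (inj₁ u) (inj₁ v) → Near G u v
      near₁ = Sum.map₁ Sum.inj₁-injective
      near₂ : ∀ {u v} → Near G∪H (inj₂ u) (inj₂ v) → Near H u v
      near₂ = Sum.map₁ Sum.inj₂-injective

      far : ∀ {u v} → Near G∪H (inj₁ u) (inj₂ v) → ⊥
      far (inj₁ ())
      far (inj₂ ())

      sep : ∀ e f → Conflict G∪H e f → col e ≢ col f
      sep ((inj₁ u , inj₁ v) , a) ((inj₁ x , inj₁ y) , b) (e≁f , close) eq =
        c.separates ((u , v) , a) ((x , y) , b)
          (e≁f ∘ samePair-map inj₁ , Sum.map (Sum.map near₁ near₁) (Sum.map near₁ near₁) close)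
          (Fin.inject≤-injective s≤ s≤ _ _ eq)
      sep ((inj₂ u , inj₂ v) , a) ((inj₂ x , inj₂ y) , b) (e≁f , close) eq =
        d.separates ((u , v) , a) ((x , y) , b)
          (e≁f ∘ samePair-map inj₂ , Sum.map (Sum.map near₂ near₂) (Sum.map near₂ near₂) close)
          (Fin.inject≤-injective t≤ t≤ _ _ eq)
      sep ((inj₁ u , inj₁ v) , a) ((inj₂ x , inj₂ y) , b) (_ , close) _ =
        [ [ far , far ]′ , [ far , far ]′ ]′ close
      sep ((inj₂ u , inj₂ v) , a) ((inj₁ x , inj₁ y) , b) (_ , close) _ =
        [ [ far , far ]′ , [ far , far ]′ ]′ (close-sym G∪H {inj₂ u , inj₂ v} {inj₁ x , inj₁ y} close)

    -- The summands keep the three kinds of edges apart. A crossing edge is its own colour, written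
    -- with the end in `V` first so that the orientation does not matter.
    join-colouring : ConflictColouring G+H (Fin s ⊎ Fin t ⊎ (V × W))
    join-colouring = record { colour = col ; well-formed = wf ; separates = sep }
      where
      col : Edge G+H → Fin s ⊎ Fin t ⊎ (V × W)
      col ((inj₁ u , inj₁ v) , a) = inj₁ (c.colour ((u , v) , a))
      col ((inj₂ u , inj₂ v) , a) = inj₂ (inj₁ (d.colour ((u , v) , a)))
      col ((inj₁ u , inj₂ v) , _) = inj₂ (inj₂ (u , v))
      col ((inj₂ u , inj₁ v) , _) = inj₂ (inj₂ (v , u))

      wf : ∀ e f → SameEdge G+H e f → col e ≡ col f
      wf ((inj₁ u , inj₁ v) , a) ((inj₁ x , inj₁ y) , b) s =
        cong inj₁ (c.well-formed _ _ (samePair-injective Sum.inj₁-injective s))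
      wf ((inj₂ u , inj₂ v) , a) ((inj₂ x , inj₂ y) , b) s =
        cong (inj₂ ∘ inj₁) (d.well-formed _ _ (samePair-injective Sum.inj₂-injective s))
      wf ((inj₁ u , inj₂ v) , a) ((inj₁ x , inj₂ y) , b) (inj₁ (refl , refl)) = refl
      wf ((inj₁ u , inj₂ v) , a) ((inj₂ x , inj₁ y) , b) (inj₂ (refl , refl)) = refl
      wf ((inj₂ u , inj₁ v) , a) ((inj₁ x , inj₂ y) , b) (inj₂ (refl , refl)) = refl
      wf ((inj₂ u , inj₁ v) , a) ((inj₂ x , inj₁ y) , b) (inj₁ (refl , refl)) = refl
      wf ((inj₁ _ , inj₁ _) , _) ((inj₂ _ , inj₂ _) , _) (inj₁ (() , _))
      wf ((inj₁ _ , inj₁ _) , _) ((inj₂ _ , inj₂ _) , _) (inj₂ (() , _))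
      wf ((inj₂ _ , inj₂ _) , _) ((inj₁ _ , inj₁ _) , _) (inj₁ (() , _))
      wf ((inj₂ _ , inj₂ _) , _) ((inj₁ _ , inj₁ _) , _) (inj₂ (() , _))
      wf ((inj₁ _ , inj₂ _) , _) ((inj₁ _ , inj₁ _) , _) (inj₁ (_ , ()))
      wf ((inj₁ _ , inj₂ _) , _) ((inj₁ _ , inj₁ _) , _) (inj₂ (_ , ()))
      wf ((inj₁ _ , inj₂ _) , _) ((inj₂ _ , inj₂ _) , _) (inj₁ (() , _))
      wf ((inj₁ _ , inj₂ _) , _) ((inj₂ _ , inj₂ _) , _) (inj₂ (() , _))
      wf ((inj₂ _ , inj₁ _) , _) ((inj₁ _ , inj₁ _) , _) (inj₁ (() , _))
      wf ((inj₂ _ , inj₁ _) , _) ((inj₁ _ , inj₁ _) , _) (inj₂ (() , _))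
      wf ((inj₂ _ , inj₁ _) , _) ((inj₂ _ , inj₂ _) , _) (inj₁ (_ , ()))
      wf ((inj₂ _ , inj₁ _) , _) ((inj₂ _ , inj₂ _) , _) (inj₂ (_ , ()))
      wf ((inj₁ _ , inj₁ _) , _) ((inj₁ _ , inj₂ _) , _) (inj₁ (_ , ()))
      wf ((inj₁ _ , inj₁ _) , _) ((inj₁ _ , inj₂ _) , _) (inj₂ (() , _))
      wf ((inj₁ _ , inj₁ _) , _) ((inj₂ _ , inj₁ _) , _) (inj₁ (() , _))
      wf ((inj₁ _ , inj₁ _) , _) ((inj₂ _ , inj₁ _) , _) (inj₂ (_ , ()))
      wf ((inj₂ _ , inj₂ _) , _) ((inj₁ _ , inj₂ _) , _) (inj₁ (() , _))
      wf ((inj₂ _ , inj₂ _) , _) ((inj₁ _ , inj₂ _) , _) (inj₂ (_ , ()))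
      wf ((inj₂ _ , inj₂ _) , _) ((inj₂ _ , inj₁ _) , _) (inj₁ (_ , ()))
      wf ((inj₂ _ , inj₂ _) , _) ((inj₂ _ , inj₁ _) , _) (inj₂ (() , _))

      near₁ : ∀ {u v} → Near G+H (inj₁ u) (inj₁ v) → Near G u v
      near₁ = Sum.map₁ Sum.inj₁-injective
      near₂ : ∀ {u v} → Near G+H (inj₂ u) (inj₂ v) → Near H u v
      near₂ = Sum.map₁ Sum.inj₂-injective

      sep : ∀ e f → Conflict G+H e f → col e ≢ col f
      sep ((inj₁ u , inj₁ v) , a) ((inj₁ x , inj₁ y) , b) (e≁f , close) eq =
        c.separates ((u , v) , a) ((x , y) , b)
          (e≁f ∘ samePair-map inj₁ , Sum.map (Sum.map near₁ near₁) (Sum.map near₁ near₁) close)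
          (Sum.inj₁-injective eq)
      sep ((inj₂ u , inj₂ v) , a) ((inj₂ x , inj₂ y) , b) (e≁f , close) eq =
        d.separates ((u , v) , a) ((x , y) , b)
          (e≁f ∘ samePair-map inj₂ , Sum.map (Sum.map near₂ near₂) (Sum.map near₂ near₂) close)
          (Sum.inj₁-injective (Sum.inj₂-injective eq))
      sep ((inj₁ u , inj₂ v) , a) ((inj₁ x , inj₂ y) , b) (e≁f , _) refl = e≁f (inj₁ (refl , refl))
      sep ((inj₁ u , inj₂ v) , a) ((inj₂ x , inj₁ y) , b) (e≁f , _) refl = e≁f (inj₂ (refl , refl))
      sep ((inj₂ u , inj₁ v) , a) ((inj₁ x , inj₂ y) , b) (e≁f , _) refl = e≁f (inj₂ (refl , refl))
      sep ((inj₂ u , inj₁ v) , a) ((inj₂ x , inj₁ y) , b) (e≁f , _) refl = e≁f (inj₁ (refl , refl))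
      sep ((inj₁ _ , inj₁ _) , _) ((inj₂ _ , inj₂ _) , _) _ ()
      sep ((inj₁ _ , inj₁ _) , _) ((inj₁ _ , inj₂ _) , _) _ ()
      sep ((inj₁ _ , inj₁ _) , _) ((inj₂ _ , inj₁ _) , _) _ ()
      sep ((inj₂ _ , inj₂ _) , _) ((inj₁ _ , inj₁ _) , _) _ ()
      sep ((inj₂ _ , inj₂ _) , _) ((inj₁ _ , inj₂ _) , _) _ ()
      sep ((inj₂ _ , inj₂ _) , _) ((inj₂ _ , inj₁ _) , _) _ ()
      sep ((inj₁ _ , inj₂ _) , _) ((inj₁ _ , inj₁ _) , _) _ ()
      sep ((inj₁ _ , inj₂ _) , _) ((inj₂ _ , inj₂ _) , _) _ ()
      sep ((inj₂ _ , inj₁ _) , _) ((inj₁ _ , inj₁ _) , _) _ ()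
      sep ((inj₂ _ , inj₁ _) , _) ((inj₂ _ , inj₂ _) , _) _ ()

  union-edge₁ : Edge G → Edge G∪H
  union-edge₁ ((u , v) , a) = (inj₁ u , inj₁ v) , a

  union-edge₂ : Edge H → Edge G∪H
  union-edge₂ ((u , v) , a) = (inj₂ u , inj₂ v) , a

  join-edge₁ : Edge G → Edge G+H
  join-edge₁ ((u , v) , a) = (inj₁ u , inj₁ v) , a

  join-edge₂ : Edge H → Edge G+H
  join-edge₂ ((u , v) , a) = (inj₂ u , inj₂ v) , a

  cross-edge : V × W → Edge G+H
  cross-edge (u , v) = (inj₁ u , inj₂ v) , tt

  private
    close-map : {X Y : Set} (K : Graph X) (L : Graph Y) (f : X → Y) →
                (∀ {u v} → Graph._~_ K u v → Graph._~_ L (f u) (f v)) → ∀ {p q} →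
                Close K p q → Close L (f (proj₁ p) , f (proj₂ p)) (f (proj₁ q) , f (proj₂ q))
    close-map K L f hom = Sum.map (Sum.map near near) (Sum.map near near)
      where
      near : ∀ {u v} → Near K u v → Near L (f u) (f v)
      near = Sum.map (cong f) hom

    conflict-map : {X Y : Set} (K : Graph X) (L : Graph Y) (f : X → Y) → Injective _≡_ _≡_ f →
                   (hom : ∀ {u v} → Graph._~_ K u v → Graph._~_ L (f u) (f v)) →
                   {e e′ : Edge K} → Conflict K e e′ →
                   Conflict L ((f (proj₁ (proj₁ e)) , f (proj₂ (proj₁ e))) , hom (proj₂ e))
                              ((f (proj₁ (proj₁ e′)) , f (proj₂ (proj₁ e′))) , hom (proj₂ e′))
    conflict-map K L f inj hom {e} {e′} (e≁e′ , close) =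
      e≁e′ ∘ samePair-injective inj , close-map K L f hom {proj₁ e} {proj₁ e′} close

  union-certificate : ∀ {s t} → Certificate G s → Certificate H t → Certificate G∪H (s ⊔ t)
  union-certificate {s} {t} C D with ℕ.≤-total t s
  ... | inj₁ t≤s = record
    { colouring = union-colouring C.colouring D.colouring
    ; clique    = map union-edge₁ C.clique
    ; isClique  = AllPairs.map⁺ (AllPairs.map
        (λ {e} {e′} → conflict-map G G∪H inj₁ Sum.inj₁-injective (λ a → a) {e} {e′}) C.isClique)
    ; size      = trans (length-map union-edge₁ C.clique) (trans C.size (sym (ℕ.m≥n⇒m⊔n≡m t≤s)))
    }
    where
    module C = Certificate C
    module D = Certificate D
  ... | inj₂ s≤t = record
    { colouring = union-colouring C.colouring D.colouring
    ; clique    = map union-edge₂ D.clique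
    ; isClique  = AllPairs.map⁺ (AllPairs.map
        (λ {e} {e′} → conflict-map H G∪H inj₂ Sum.inj₂-injective (λ a → a) {e} {e′}) D.isClique)
    ; size      = trans (length-map union-edge₂ D.clique) (trans D.size (sym (ℕ.m≤n⇒m⊔n≡n s≤t)))
    }
    where
    module C = Certificate C
    module D = Certificate D

  join-certificate : ∀ {m n s t} → V ↔ Fin m → W ↔ Fin n → Certificate G s → Certificate H t →
                     Certificate G+H (s + (t + m * n))
  join-certificate {m} {n} {s} {t} V↔ W↔ C D = record
    { colouring = recolour G+H (Inverse.to encoding) (to-injective encoding) (join-colouring C.colouring D.colouring)
    ; clique    = inside₁ ++ inside₂ ++ across
    ; isClique  = AllPairs.++⁺
        (AllPairs.map⁺ (AllPairs.map
          (λ {e} {e′} → conflict-map G G+H inj₁ Sum.inj₁-injective (λ a → a) {e} {e′}) C.isClique))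
        (AllPairs.++⁺
          (AllPairs.map⁺ (AllPairs.map
          (λ {e} {e′} → conflict-map H G+H inj₂ Sum.inj₂-injective (λ a → a) {e} {e′}) D.isClique))
          (AllPairs.map⁺ (AllPairs.map across-conflict
            (Unique.cartesianProduct⁺ (Unique.allFin⁺ m) (Unique.allFin⁺ n))))
          (All.tabulate λ e∈ → All.tabulate λ f∈ → inside₂-across e∈ f∈))
        (All.tabulate λ e∈ → All.tabulate λ f∈ →
          [ inside₁-inside₂ e∈ , inside₁-across e∈ ]′ (∈-++⁻ inside₂ f∈))
    ; size      = trans (length-++ inside₁) (cong₂ _+_
        (trans (length-map join-edge₁ C.clique) C.size)
        (trans (length-++ inside₂) (cong₂ _+_
          (trans (length-map join-edge₂ D.clique) D.size)
          (trans (length-map pick (cartesianProduct (allFin m) (allFin n)))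
            (trans (length-cartesianProduct (allFin m) (allFin n))
              (cong₂ _*_ (length-allFin m) (length-allFin n)))))))
    }
    where
    module C = Certificate C
    module D = Certificate D
    module V↔ = Inverse V↔
    module W↔ = Inverse W↔

    encoding : (Fin s ⊎ Fin t ⊎ (V × W)) ↔ Fin (s + (t + m * n))
    encoding = ↔-trans (↔-refl ⊎-↔ ↔-trans (↔-refl ⊎-↔ ↔-trans (V↔ ×-↔ W↔) (↔-sym Fin.*↔×))
                                           (↔-sym Fin.+↔⊎))
                       (↔-sym Fin.+↔⊎)

    inside₁ = map join-edge₁ C.clique
    inside₂ = map join-edge₂ D.clique

    pick : Fin m × Fin n → Edge G+H
    pick (i , j) = cross-edge (V↔.from i , W↔.from j)

    across = map pick (cartesianProduct (allFin m) (allFin n))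

    across-conflict : ∀ {p q} → p ≢ q → Conflict G+H (pick p) (pick q)
    across-conflict p≢q =
      (λ { (inj₁ (a , b)) → p≢q (cong₂ _,_ (from-injective V↔ (Sum.inj₁-injective a))
                                           (from-injective W↔ (Sum.inj₂-injective b))) })
      , inj₁ (inj₂ (inj₂ tt))

    inside₁-inside₂ : ∀ {e f} → e ∈ inside₁ → f ∈ inside₂ → Conflict G+H e f
    inside₁-inside₂ e∈ f∈ with ∈-map⁻ join-edge₁ e∈ | ∈-map⁻ join-edge₂ f∈
    ... | _ , _ , refl | _ , _ , refl =
      (λ { (inj₁ (() , _)) ; (inj₂ (() , _)) }) , inj₁ (inj₁ (inj₂ tt))

    inside₁-across : ∀ {e f} → e ∈ inside₁ → f ∈ across → Conflict G+H e f
    inside₁-across e∈ f∈ with ∈-map⁻ join-edge₁ e∈ | ∈-map⁻ pick f∈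
    ... | _ , _ , refl | _ , _ , refl =
      (λ { (inj₁ (_ , ())) ; (inj₂ (() , _)) }) , inj₁ (inj₂ (inj₂ tt))

    inside₂-across : ∀ {e f} → e ∈ inside₂ → f ∈ across → Conflict G+H e f
    inside₂-across e∈ f∈ with ∈-map⁻ join-edge₂ e∈ | ∈-map⁻ pick f∈
    ... | _ , _ , refl | _ , _ , refl =
      (λ { (inj₁ (() , _)) ; (inj₂ (_ , ())) }) , inj₁ (inj₁ (inj₂ tt))

-- Degrees and weights read off the edge words

indicator : {A : Set} → Dec A → ℕ
indicator d = if does d then 1 else 0

occurrences : ℕ → List ℕ → ℕ
occurrences i []       = 0
occurrences i (w ∷ ws) = indicator (i ℕ.≟ w) + occurrences i ws

module _ {m : ℕ} (d : ℕ → ℕ) where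

  -- One is subtracted because uv itself is counted at both ends.
  weight : Fin m × Fin m → ℕ
  weight (u , v) = d (toℕ u) + d (toℕ v) ∸ 1

  heaviest : List (Fin m × Fin m) → ℕ
  heaviest []       = 0
  heaviest (e ∷ es) = weight e ⊔ heaviest es

  heaviest-upper : ∀ {e es} → e ∈ es → weight e ≤ heaviest es
  heaviest-upper (here refl) = ℕ.m≤m⊔n _ _
  heaviest-upper (there e∈)  = ℕ.≤-trans (heaviest-upper e∈) (ℕ.m≤n⊔m _ _)

  heaviest-attained : ∀ e es → ∃[ f ] f ∈ e ∷ es × weight f ≡ heaviest (e ∷ es)
  heaviest-attained e [] = e , here refl , sym (ℕ.⊔-identityʳ _)
  heaviest-attained e (e′ ∷ es) with f , f∈ , eq ← heaviest-attained e′ es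
    with ℕ.⊔-sel (weight e) (heaviest (e′ ∷ es))
  ... | inj₁ first = e , here refl , sym first
  ... | inj₂ rest  = f , there f∈ , trans eq (sym rest)

  heaviest-least : ∀ {k} es → (∀ {e} → e ∈ es → weight e ≤ k) → heaviest es ≤ k
  heaviest-least []       _  = z≤n
  heaviest-least (e ∷ es) le = ℕ.⊔-lub (le (here refl)) (heaviest-least es (le ∘ there))

-- Each listed edge contributes its two ends to the words, so occurrences are degrees and this is
-- the maximum of deg u + deg v - 1. It is stated on the list because this is what the program
-- evaluates.
treeIndex : ∀ {m} → List (Fin m × Fin m) → ℕ
treeIndex es = heaviest (λ i → occurrences i (edgeWords es)) es

meet? : ∀ {m} (p q : Fin m × Fin m) → Dec (Meet p q)
meet? (u , v) (x , y) = ((u Fin.≟ x) ⊎-dec (u Fin.≟ y)) ⊎-dec ((v Fin.≟ x) ⊎-dec (v Fin.≟ y))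

same? : ∀ {m} (p q : Fin m × Fin m) → Dec (SamePair p q)
same? = samePair? Fin._≟_

indicator-toℕ : ∀ {m} (x y : Fin m) → indicator (toℕ x ℕ.≟ toℕ y) ≡ indicator (x Fin.≟ y)
indicator-toℕ x y = cong (λ b → if b then 1 else 0)
  (does-⇔ (mk⇔ Fin.toℕ-injective (cong toℕ)) (toℕ x ℕ.≟ toℕ y) (x Fin.≟ y))

length-filter-∷ : {A : Set} {P : A → Set} (P? : ∀ x → Dec (P x)) → ∀ x xs →
                  length (filter P? (x ∷ xs)) ≡ indicator (P? x) + length (filter P? xs)
length-filter-∷ P? x xs with does (P? x)
... | true  = refl
... | false = refl

-- Two edges share no end, one end or both. Sharing both makes them the same pair, and the second
-- term on the right accounts for the second coincidence.
indicator-ends : ∀ {m} {a b x y : Fin m} → a ≢ b → x ≢ y →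
                 (indicator (a Fin.≟ x) + indicator (a Fin.≟ y)) + (indicator (b Fin.≟ x) + indicator (b Fin.≟ y))
                 ≡ indicator (meet? (a , b) (x , y)) + indicator (same? (a , b) (x , y))
indicator-ends {a = a} {b} {x} {y} a≢b x≢y with a Fin.≟ x | a Fin.≟ y | b Fin.≟ x | b Fin.≟ y
... | yes refl | yes refl | _ | _ = contradiction refl x≢y
... | yes refl | no _ | yes refl | _ = contradiction refl a≢b
... | yes refl | no _ | no _ | yes _ = refl
... | yes refl | no _ | no _ | no _ = refl
... | no _ | yes refl | yes _ | yes refl = contradiction refl a≢b
... | no _ | yes refl | yes _ | no _ = refl
... | no _ | yes refl | no _ | yes refl = contradiction refl a≢b
... | no _ | yes refl | no _ | no _ = refl
... | no _ | no _ | yes refl | yes refl = contradiction refl x≢y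
... | no _ | no _ | yes refl | no _ = refl
... | no _ | no _ | no _ | yes refl = refl
... | no _ | no _ | no _ | no _ = refl

lift-All : {A : Set} {P : A → Set} {xs : List A} → All P xs → ∃[ ys ] map (proj₁ {B = P}) ys ≡ xs
lift-All []         = [] , refl
lift-All (px ∷ pxs) with ys , eq ← lift-All pxs = (_ , px) ∷ ys , cong (_ ∷_) eq

module _ {m : ℕ} (G : Graph (Fin m)) where
  open Graph G

  -- An encoding lists bare pairs, whereas cliques consist of pairs with adjacency proofs. Matching
  -- on the equation passes from the former to the latter without changing the words.
  lift-edges : ∀ {es} → es ListsEdgesOf G → ∃[ edges ] map (proj₁ {B = λ (u , v) → u ~ v}) edges ≡ es
  lift-edges (complete , _) =
    lift-All (All.tabulate λ {(u , v)} e∈ → Equivalence.from (complete u v) (inj₁ e∈))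

  -- `indicator-ends`, summed over the list. For an edge ab of a listed tree the last summand is
  -- one, by `copies`.
  degree-sum : ∀ edges {a b : Fin m} → a ≢ b → let ws = edgeWords (map proj₁ edges) in
               occurrences (toℕ a) ws + occurrences (toℕ b) ws
               ≡ length (filter (λ (e : Edge G) → meet? (a , b) (proj₁ e)) edges)
                 + length (filter (λ (e : Edge G) → same? (a , b) (proj₁ e)) edges)
  degree-sum [] _ = refl
  degree-sum (e@((x , y) , x~y) ∷ edges) {a} {b} a≢b
    rewrite length-filter-∷ (λ (e : Edge G) → meet? (a , b) (proj₁ e)) e edges
          | length-filter-∷ (λ (e : Edge G) → same? (a , b) (proj₁ e)) e edges
          | indicator-toℕ a x | indicator-toℕ a y | indicator-toℕ b x | indicator-toℕ b y = begin
    (i + (j + A)) + (k + (l + B)) ≡⟨ regroup i j k l A B ⟩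
    ((i + j) + (k + l)) + (A + B) ≡⟨ cong₂ _+_ (indicator-ends a≢b (λ eq → ~-irrefl eq x~y)) (degree-sum edges a≢b) ⟩
    (t + s) + (N + S)             ≡⟨ regroup′ t s N S ⟩
    (t + N) + (s + S)             ∎
    where
    open ≡-Reasoning
    open +-*-Solver
    i = indicator (a Fin.≟ x)
    j = indicator (a Fin.≟ y)
    k = indicator (b Fin.≟ x)
    l = indicator (b Fin.≟ y)
    A = occurrences (toℕ a) (edgeWords (map proj₁ edges))
    B = occurrences (toℕ b) (edgeWords (map proj₁ edges))
    t = indicator (meet? (a , b) (x , y))
    s = indicator (same? (a , b) (x , y))
    N = length (filter (λ (e : Edge G) → meet? (a , b) (proj₁ e)) edges)
    S = length (filter (λ (e : Edge G) → same? (a , b) (proj₁ e)) edges)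
    regroup : ∀ i j k l A B → (i + (j + A)) + (k + (l + B)) ≡ ((i + j) + (k + l)) + (A + B)
    regroup = solve 6 (λ i j k l A B → (i :+ (j :+ A)) :+ (k :+ (l :+ B)) := ((i :+ j) :+ (k :+ l)) :+ (A :+ B)) refl
    regroup′ : ∀ t s N S → (t + s) + (N + S) ≡ (t + N) + (s + S)
    regroup′ = solve 4 (λ t s N S → (t :+ s) :+ (N :+ S) := (t :+ N) :+ (s :+ S)) refl

-- Optimal colourings of trees

module ListedTree {m} (G : Graph (Fin m)) (G-tree : IsTree G) (edges : List (Edge G))
                  (listed : map proj₁ edges ListsEdgesOf G) where
  open Graph G
  open Tree G G-tree

  private
    V = Fin m
    es = map proj₁ edges

  distinct : AllPairs (λ e f → ¬ SameEdge G e f) edges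
  distinct = AllPairs.map⁻ (proj₂ listed)

  present : ∀ e → ∃[ f ] f ∈ edges × SameEdge G e f
  present ((u , v) , u~v) with Equivalence.to (proj₁ listed u v) u~v
  ... | inj₁ e∈ with f , f∈ , refl ← ∈-map⁻ proj₁ e∈ = f , f∈ , inj₁ (refl , refl)
  ... | inj₂ e∈ with f , f∈ , refl ← ∈-map⁻ proj₁ e∈ = f , f∈ , inj₂ (refl , refl)

  listedAs : ∀ {v} → v ≢ root → ∃[ f ] f ∈ edges × SamePair (parentEdge v) (proj₁ f) × child f ≡ v
  listedAs {v} v≢root with f , f∈ , s ← present (parentEdge v , proj₁ (parent-spec v≢root)) =
    f , f∈ , s , child-unique f v≢root (samePair-sym s)

  -- The root together with the lower ends of the edges lists every vertex exactly once.
  edge-count : suc (length es) ≡ m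
  edge-count rewrite length-map (proj₁ {B = λ (u , v) → u ~ v}) edges | sym (length-map child edges) =
    ℕ.≤-antisym (unique-length unique) (complete-length complete)
    where
    unique : Unique (root ∷ map child edges)
    unique = All.tabulate (λ c∈ → λ { refl → let e , _ , eq = ∈-map⁻ child c∈ in child≢root e (sym eq) })
           ∷ AllPairs.map⁺ (AllPairs.map (λ {e} {f} e≁f eq → e≁f (child≡⇒same e f eq)) distinct)

    complete : ∀ v → v ∈ root ∷ map child edges
    complete v with v Fin.≟ root
    ... | yes refl = here refl
    ... | no v≢root with f , f∈ , _ , refl ← listedAs v≢root = there (∈-map⁺ child f∈)

  touching : V × V → List (Edge G)
  touching p = filter (λ e → meet? p (proj₁ e)) edges

  private
    w = weight {m} (λ i → occurrences i (edgeWords es))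

    copies : (e : Edge G) → length (filter (λ f → same? (proj₁ e) (proj₁ f)) edges) ≡ 1
    copies e with f , f∈ , s ← present e =
      exactly-one (∈-filter⁺ P? f∈ s) (AllPairs.filter⁺ P? distinct) (λ g∈ → proj₂ (∈-filter⁻ P? {xs = edges} g∈))
      where
      P? = λ (f : Edge G) → same? (proj₁ e) (proj₁ f)
      exactly-one : ∀ {f fs} → f ∈ fs → AllPairs (λ e f → ¬ SameEdge G e f) fs →
                    (∀ {g} → g ∈ fs → SamePair (proj₁ e) (proj₁ g)) → length fs ≡ 1
      exactly-one {fs = _ ∷ []}    _ _ _ = refl
      exactly-one {fs = _ ∷ _ ∷ _} _ ((≁ ∷ _) ∷ _) same = contradiction
        (samePair-trans (samePair-sym (same (here refl))) (same (there (here refl)))) ≁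

  length-touching : (e : Edge G) → length (touching (proj₁ e)) ≡ w (proj₁ e)
  length-touching e@((a , b) , a~b) = sym (begin
    w (a , b)                         ≡⟨ cong (_∸ 1) (degree-sum G edges (λ eq → ~-irrefl eq a~b)) ⟩
    length (touching (a , b)) + _ ∸ 1 ≡⟨ cong (λ c → length (touching (a , b)) + c ∸ 1) (copies e) ⟩
    length (touching (a , b)) + 1 ∸ 1 ≡⟨ ℕ.m+n∸n≡m _ 1 ⟩
    length (touching (a , b))         ∎)
    where open ≡-Reasoning

  weight-upper : (e : Edge G) → w (proj₁ e) ≤ treeIndex es
  weight-upper e@((u , v) , _) with Equivalence.to (proj₁ listed u v) (proj₂ e)
  ... | inj₁ e∈ = heaviest-upper _ e∈
  ... | inj₂ e∈ = ℕ.≤-trans (ℕ.≤-reflexive (cong (_∸ 1) (ℕ.+-comm (degree u) (degree v)))) (heaviest-upper _ e∈)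
    where
    degree : V → ℕ
    degree x = occurrences (toℕ x) (edgeWords es)

  index-upper : treeIndex es ≤ length es
  index-upper = heaviest-least _ es λ e∈ → let e , _ , eq = ∈-map⁻ proj₁ e∈ in
    subst (λ p → w p ≤ length es) (sym eq) (begin
      w (proj₁ e)                 ≡⟨ length-touching e ⟨
      length (touching (proj₁ e)) ≤⟨ length-filter (λ f → meet? (proj₁ e) (proj₁ f)) edges ⟩
      length edges                ≡⟨ length-map proj₁ edges ⟨
      length es                   ∎)
    where open ℕ.≤-Reasoning

  -- Conflict of edges in terms of their lower ends, since `greedy` colours elements of `Fin`; the
  -- root stands for no edge.
  VertexConflict : Rel V 0ℓ
  VertexConflict v w = (v ≢ root × w ≢ root) × v ≢ w × Close G (parentEdge v) (parentEdge w)

  hub : V → V × V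
  hub v = if does (parent v Fin.≟ root) then parentEdge v else parentEdge (parent v)

  hub-edge : ∀ {v} → v ≢ root → proj₁ (hub v) ~ proj₂ (hub v)
  hub-edge {v} v≢root with parent v Fin.≟ root
  ... | yes _ = proj₁ (parent-spec v≢root)
  ... | no u≢root = proj₁ (parent-spec u≢root)

  hub-meets-own : ∀ v → Meet (hub v) (parentEdge v)
  hub-meets-own v with parent v Fin.≟ root
  ... | yes _ = inj₁ (inj₁ refl)
  ... | no _  = inj₂ (inj₁ refl)

  forbidden : V → List V
  forbidden v with v Fin.≟ root
  ... | yes _ = []
  ... | no _  = filter (λ w → ¬? (w Fin.≟ v)) (map child (touching (hub v)))

  meet-resp : ∀ {p q r : V × V} → SamePair q r → Meet p q → Meet p r
  meet-resp (inj₁ (refl , refl)) m = m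
  meet-resp (inj₂ (refl , refl)) m = Sum.map Sum.swap Sum.swap m

  child∈touching : ∀ {p v} → v ≢ root → Meet p (parentEdge v) → v ∈ map child (touching p)
  child∈touching {p} v≢root meet with f , f∈ , s , refl ← listedAs v≢root =
    ∈-map⁺ child (∈-filter⁺ (λ e → meet? p (proj₁ e)) f∈ (meet-resp {p} s meet))

  -- Of the edges ending no deeper than v, only those at the parent u of v or at
  -- the parent of u conflict with uv.
  conflict-meets-hub : ∀ {v w} → VertexConflict v w → depth w ≤ depth v → Meet (hub v) (parentEdge w)
  conflict-meets-hub {v} {w} ((v≢root , w≢root) , v≢w , close) dw≤dv = at-hub (cases close)
    where
    u = parent v
    x = parent w
    du : depth v ≡ suc (depth u)
    du = proj₂ (parent-spec v≢root)
    dx : depth w ≡ suc (depth x)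
    dx = proj₂ (parent-spec w≢root)

    dx≤du : depth x ≤ depth u
    dx≤du = ℕ.≤-pred (subst₂ _≤_ dx du dw≤dv)

    dx<dv : depth x < depth v
    dx<dv = subst (suc (depth x) ≤_) (sym du) (s≤s dx≤du)

    AtHub : Set
    AtHub = (u ≡ x ⊎ u ≡ w) ⊎ (u ≢ root × (parent u ≡ x ⊎ parent u ≡ w))

    -- Orienting each adjacency either identifies a parent or puts `x` or `w` too deep.
    cases : Close G (u , v) (x , w) → AtHub
    cases (inj₁ (inj₁ (inj₁ u≡x))) = inj₁ (inj₁ u≡x)
    cases (inj₁ (inj₁ (inj₂ u~x))) with orient u~x
    ... | inj₁ (_ , eq) = contradiction (subst (_≤ depth u) eq dx≤du) (ℕ.<⇒≱ ℕ.≤-refl)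
    ... | inj₂ p = inj₂ (isParentOf⇒≢root p , inj₁ (isParentOf⇒parent p))
    cases (inj₁ (inj₂ (inj₁ u≡w))) = inj₁ (inj₂ u≡w)
    cases (inj₁ (inj₂ (inj₂ u~w))) with orient u~w
    ... | inj₁ p = inj₁ (inj₁ (sym (isParentOf⇒parent p)))
    ... | inj₂ p = inj₂ (isParentOf⇒≢root p , inj₂ (isParentOf⇒parent p))
    cases (inj₂ (inj₁ (inj₁ v≡x))) = contradiction (cong depth (sym v≡x)) (ℕ.<⇒≢ dx<dv)
    cases (inj₂ (inj₁ (inj₂ v~x))) with orient v~x
    ... | inj₁ (_ , eq) = contradiction (subst (depth v ≤_) (sym eq) (ℕ.n≤1+n _)) (ℕ.<⇒≱ dx<dv)
    ... | inj₂ p = inj₁ (inj₁ (isParentOf⇒parent p))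
    cases (inj₂ (inj₂ (inj₁ v≡w))) = contradiction v≡w v≢w
    cases (inj₂ (inj₂ (inj₂ v~w))) with orient v~w
    ... | inj₁ (_ , eq) = contradiction (subst (_≤ depth v) eq dw≤dv) (ℕ.<⇒≱ ℕ.≤-refl)
    ... | inj₂ p = inj₁ (inj₂ (isParentOf⇒parent p))

    at-hub : AtHub → Meet (hub v) (x , w)
    at-hub c with u Fin.≟ root | c
    ... | yes _      | inj₁ m           = inj₁ m
    ... | yes u≡root | inj₂ (u≢root , _) = contradiction u≡root u≢root
    ... | no _       | inj₁ m           = inj₂ m
    ... | no _       | inj₂ (_ , m)     = inj₁ m

  covered : ∀ {v w} → VertexConflict v w → depth w ≤ depth v → w ∈ forbidden v
  covered {v} {w} c@((v≢root , w≢root) , v≢w , _) dw≤dv with v Fin.≟ root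
  ... | yes v≡root = contradiction v≡root v≢root
  ... | no _ = ∈-filter⁺ (λ w → ¬? (w Fin.≟ v))
                 (child∈touching {hub v} w≢root (conflict-meets-hub c dw≤dv)) (v≢w ∘ sym)

  index-positive : Edge G → 0 < treeIndex es
  index-positive e with f , f∈ , s ← present e = begin-strict
    0                              <⟨ ∈-length (∈-filter⁺ (λ e′ → meet? (proj₁ e) (proj₁ e′)) f∈
                                      (meet-resp {proj₁ e} s (inj₁ (inj₁ refl)))) ⟩
    length (touching (proj₁ e))    ≡⟨ length-touching e ⟩
    w (proj₁ e)                    ≤⟨ weight-upper e ⟩
    treeIndex es                   ∎
    where open ℕ.≤-Reasoning

  -- The weight of the hub counts all edges meeting it, and the edge of `v` is one of these. Since
  -- `forbidden` leaves `v` out, the inequality is strict.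
  few : Edge G → ∀ v → length (forbidden v) < treeIndex es
  few e v with v Fin.≟ root
  ... | yes _ = index-positive e
  ... | no v≢root = begin-strict
    length (filter (λ w → ¬? (w Fin.≟ v)) (map child (touching (hub v))))
      <⟨ filter-notAll (λ w → ¬? (w Fin.≟ v)) _
           (Any.map (λ { refl ne → ne refl }) (child∈touching {hub v} v≢root (hub-meets-own v))) ⟩
    length (map child (touching (hub v))) ≡⟨ length-map child (touching (hub v)) ⟩
    length (touching (hub v))             ≡⟨ length-touching (hub v , hub-edge v≢root) ⟩
    w (hub v)                             ≤⟨ weight-upper (hub v , hub-edge v≢root) ⟩
    treeIndex es                          ∎
    where open ℕ.≤-Reasoning

  close-resp : ∀ {p p′ q q′ : V × V} → SamePair p p′ → SamePair q q′ → Close G p q → Close G p′ q′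
  close-resp (inj₁ (refl , refl)) (inj₁ (refl , refl)) c = c
  close-resp (inj₁ (refl , refl)) (inj₂ (refl , refl)) c = Sum.map Sum.swap Sum.swap c
  close-resp (inj₂ (refl , refl)) (inj₁ (refl , refl)) c = Sum.swap c
  close-resp (inj₂ (refl , refl)) (inj₂ (refl , refl)) c = Sum.swap (Sum.map Sum.swap Sum.swap c)

  tree-colouring : Edge G → ConflictColouring G (Fin (treeIndex es))
  tree-colouring e₀
    with c , proper ← greedy depth VertexConflict
                        (λ {v} {w} ((v≢ , w≢) , v≢w , close) →
                          (w≢ , v≢) , (v≢w ∘ sym) , close-sym G {parentEdge v} {parentEdge w} close)
                        (λ (_ , v≢v , _) → v≢v refl)
                        forbidden (few e₀) covered (fromℕ< (index-positive e₀))
    = record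
    { colour      = c ∘ child
    ; well-formed = λ e f s → cong c (same⇒child≡ e f s)
    ; separates   = λ e f (e≁f , close) → proper
        ((child≢root e , child≢root f) , e≁f ∘ child≡⇒same e f ,
         close-resp (parentEdge-child e) (parentEdge-child f) close)
    }

  tree-certificate : Certificate G (treeIndex es)
  tree-certificate = certify edges refl
    where
    certify : ∀ edges′ → edges′ ≡ edges → Certificate G (treeIndex es)
    -- With no edge the index is zero, and there is neither a default colour for `greedy` nor an
    -- edge of largest weight.
    certify [] refl = record
      { colouring = record
        { colour      = λ e → ⊥-elim (none e)
        ; well-formed = λ e → ⊥-elim (none e)
        ; separates   = λ e → ⊥-elim (none e) }
      ; clique = [] ; isClique = [] ; size = refl }
      where
      none : ¬ Edge G
      none e with () ← proj₁ (proj₂ (present e))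
    certify (e₀ ∷ edges′) refl
      with _ , f∈ , attained ← heaviest-attained (λ i → occurrences i (edgeWords es)) (proj₁ e₀) (map proj₁ edges′)
      with f , _ , refl ← ∈-map⁻ (proj₁ {B = λ (u , v) → u ~ v}) {xs = e₀ ∷ edges′} f∈ = record
      { colouring = tree-colouring e₀
      ; clique    = touching (proj₁ f)
      ; isClique  = pairwise
      ; size      = trans (length-touching f) attained
      }
      where
      P? = λ (e : Edge G) → meet? (proj₁ f) (proj₁ e)
      pairwise : Clique G (touching (proj₁ f))
      pairwise = strengthen (AllPairs.filter⁺ P? distinct) (λ e∈ → proj₂ (∈-filter⁻ P? {xs = edges} e∈))
        where
        strengthen : ∀ {gs} → AllPairs (λ e e′ → ¬ SameEdge G e e′) gs →
                     (∀ {e} → e ∈ gs → Meet (proj₁ f) (proj₁ e)) → Clique G gs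
        strengthen []          meets = []
        strengthen {e ∷ _} (≁ ∷ rest) meets =
          All.tabulate (λ {e′} e∈ → All.lookup ≁ e∈ , adjacent-adjacent⇒close G f e e′ (meets (here refl)) (meets (there e∈)))
          ∷ strengthen rest (meets ∘ there)

-- Complements of trees

-- One representative of each unordered pair. Filtering by adjacency splits the list into the edges
-- of a graph and those of its complement, so that one count yields the other.
increasingPairs : ∀ m → List (Fin m × Fin m)
increasingPairs zero    = []
increasingPairs (suc m) = map (λ j → zero , suc j) (allFin m)
                       ++ map (λ (i , j) → suc i , suc j) (increasingPairs m)

increasing : ∀ {m} {p : Fin m × Fin m} → p ∈ increasingPairs m → proj₁ p Data.Fin.< proj₂ p
increasing {suc m} p∈ with ∈-++⁻ (map (λ j → zero , suc j) (allFin m)) p∈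
... | inj₁ q∈ with _ , _ , refl ← ∈-map⁻ _ q∈ = s≤s z≤n
... | inj₂ q∈ with _ , r∈ , refl ← ∈-map⁻ _ q∈ = s≤s (increasing r∈)

increasingPairs-complete : ∀ {m} {i j : Fin m} → i Data.Fin.< j → (i , j) ∈ increasingPairs m
increasingPairs-complete {suc m} {zero}  {suc j} _         = ∈-++⁺ˡ (∈-map⁺ _ (∈-allFin j))
increasingPairs-complete {suc m} {suc i} {suc j} (s≤s i<j) =
  ∈-++⁺ʳ _ (∈-map⁺ _ (increasingPairs-complete i<j))

increasingPairs-unique : ∀ m → Unique (increasingPairs m)
increasingPairs-unique zero    = []
increasingPairs-unique (suc m) = Unique.++⁺
  (Unique.map⁺ (λ { refl → refl }) (Unique.allFin⁺ m))
  (Unique.map⁺ (λ { refl → refl }) (increasingPairs-unique m))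
  (λ (p∈ , q∈) → disjoint (∈-map⁻ _ p∈) (∈-map⁻ _ q∈))
  where
  disjoint : ∀ {p} → ∃ (λ j → j ∈ allFin m × p ≡ (zero , suc j)) →
             ∃ (λ q → q ∈ increasingPairs m × p ≡ (suc (proj₁ q) , suc (proj₂ q))) → ⊥
  disjoint (_ , _ , refl) (_ , _ , ())

length-increasingPairs : ∀ m → length (increasingPairs (suc m)) ≡ m + length (increasingPairs m)
length-increasingPairs m = trans (length-++ (map (λ j → zero , suc j) (allFin m)))
  (cong₂ _+_ (trans (length-map _ (allFin m)) (length-allFin m)) (length-map _ (increasingPairs m)))

-- The induction runs on twice the length, where no truncated division intervenes.
triangular : ∀ m → length (increasingPairs m) ≡ (m * (m ∸ 1)) / 2
triangular m = trans (sym (m*n/n≡m _ 2)) (cong (_/ 2) (double m))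
  where
  open ≡-Reasoning
  open +-*-Solver
  double : ∀ m → length (increasingPairs m) * 2 ≡ m * (m ∸ 1)
  double zero = refl
  double (suc zero) = refl
  double (suc (suc m)) = begin
    length (increasingPairs (2 + m)) * 2           ≡⟨ cong (_* 2) (length-increasingPairs (suc m)) ⟩
    (suc m + length (increasingPairs (suc m))) * 2 ≡⟨ ℕ.*-distribʳ-+ 2 (suc m) _ ⟩
    suc m * 2 + length (increasingPairs (suc m)) * 2 ≡⟨ cong (suc m * 2 +_) (double (suc m)) ⟩
    suc m * 2 + suc m * m                          ≡⟨ solve 1 (λ m → (con 1 :+ m) :* con 2 :+ (con 1 :+ m) :* m
                                                            := (con 2 :+ m) :* (con 1 :+ m)) refl m ⟩
    (2 + m) * suc m                                ∎

length-partition : {A : Set} {P : A → Set} (P? : ∀ x → Dec (P x)) → ∀ xs →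
                   length (filter P? xs) + length (filter (¬? ∘ P?) xs) ≡ length xs
length-partition P? [] = refl
length-partition P? (x ∷ xs) with does (P? x)
... | true  = cong suc (length-partition P? xs)
... | false = trans (ℕ.+-suc _ _) (cong suc (length-partition P? xs))

module _ {m} (G : Graph (Fin m)) (G-tree : IsTree G) where
  private
    module G = Graph G
    G̅ = complement G
    adjacent? = λ ((u , v) : Fin m × Fin m) → u G.~? v
    treePairs  = filter adjacent? (increasingPairs m)
    otherPairs = filter (¬? ∘ adjacent?) (increasingPairs m)

    increasing-distinct : ∀ {ps} → (∀ {p : Fin m × Fin m} → p ∈ ps → proj₁ p Data.Fin.< proj₂ p) → Unique ps →
                          AllPairs (λ p q → ¬ SamePair p q) ps
    increasing-distinct inc [] = []
    increasing-distinct inc (p∉ ∷ uniq) =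
      All.tabulate (λ q∈ → λ { (inj₁ (refl , refl)) → All.lookup p∉ q∈ refl
                             ; (inj₂ (refl , refl)) → ℕ.<-asym (inc (here refl)) (inc (there q∈)) })
      ∷ increasing-distinct (inc ∘ there) uniq

    normalise : (e : Edge G̅) → ∃[ p ] p ∈ otherPairs × SamePair (proj₁ e) p
    normalise ((u , v) , u≢v , u≁v) with Fin.<-cmp u v
    ... | Binary.tri< u<v _ _ = _ , ∈-filter⁺ (¬? ∘ adjacent?) (increasingPairs-complete u<v) u≁v , inj₁ (refl , refl)
    ... | Binary.tri≈ _ u≡v _ = contradiction u≡v u≢v
    ... | Binary.tri> _ _ v<u = _ , ∈-filter⁺ (¬? ∘ adjacent?) (increasingPairs-complete v<u) (u≁v ∘ G.~-sym) , inj₂ (refl , refl)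

    treePairs-list : treePairs ListsEdgesOf G
    treePairs-list =
      (λ u v → mk⇔ (to u v) [ (λ e∈ → proj₂ (∈-filter⁻ adjacent? {xs = increasingPairs m} e∈))
                             , (λ e∈ → G.~-sym (proj₂ (∈-filter⁻ adjacent? {xs = increasingPairs m} e∈))) ]′) ,
      AllPairs.filter⁺ adjacent? (increasing-distinct (increasing {m}) (increasingPairs-unique m))
      where
      to : ∀ u v → u G.~ v → (u , v) ∈ treePairs ⊎ (v , u) ∈ treePairs
      to u v u~v with Fin.<-cmp u v
      ... | Binary.tri< u<v _ _ = inj₁ (∈-filter⁺ adjacent? (increasingPairs-complete u<v) u~v)
      ... | Binary.tri≈ _ u≡v _ = contradiction u~v (G.~-irrefl u≡v)
      ... | Binary.tri> _ _ v<u = inj₂ (∈-filter⁺ adjacent? (increasingPairs-complete v<u) (G.~-sym u~v))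

  tree-edge-count : ∀ {es} → es ListsEdgesOf G → suc (length es) ≡ m
  tree-edge-count listed with edges , refl ← lift-edges G listed =
    ListedTree.edge-count G G-tree edges listed

  -- The k edges of a tree on k + 1 vertices are as many as the pairs containing vertex zero, so the
  -- remaining pairs are as many as the pairs on k vertices.
  length-otherPairs : length otherPairs ≡ ((m ∸ 1) * (m ∸ 2)) / 2
  length-otherPairs = count m refl
    where
    count : ∀ k → k ≡ m → length otherPairs ≡ ((k ∸ 1) * (k ∸ 2)) / 2
    count zero    refl with () ← proj₁ (proj₁ G-tree)
    count (suc k) refl = trans (ℕ.+-cancelˡ-≡ k _ _ (begin
      k + length otherPairs                ≡⟨ cong (_+ length otherPairs) (ℕ.suc-injective (tree-edge-count treePairs-list)) ⟨
      length treePairs + length otherPairs ≡⟨ length-partition adjacent? (increasingPairs (suc k)) ⟩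
      length (increasingPairs (suc k))     ≡⟨ length-increasingPairs k ⟩
      k + length (increasingPairs k)       ∎)) (triangular k)
      where open ≡-Reasoning

  -- Two edges of the complement that neither meet nor are joined span a 4-cycle of G.
  complement-close : (e f : Edge G̅) → Close G̅ (proj₁ e) (proj₁ f)
  complement-close ((u , v) , u≢v , _) ((x , y) , x≢y , _)
    with near? u x | near? u y | near? v x | near? v y
    where
    near? : ∀ a b → Dec (Near G̅ a b)
    near? a b = (a Fin.≟ b) ⊎-dec Graph._~?_ G̅ a b
  ... | yes c | _ | _ | _ = inj₁ (inj₁ c)
  ... | no _ | yes c | _ | _ = inj₁ (inj₂ c)
  ... | no _ | no _ | yes c | _ = inj₂ (inj₁ c)
  ... | no _ | no _ | no _ | yes c = inj₂ (inj₂ c)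
  ... | no ux | no uy | no vx | no vy = ⊥-elim (proj₂ G-tree record
    { first = u ; inner = x ∷ v ∷ [] ; last = y ; inner≢[] = λ ()
    ; path = adjacent ux ∷ G.~-sym (adjacent vx) ∷ adjacent vy ∷ [-]
    ; distinct = (ux ∘ inj₁ ∷ u≢v ∷ uy ∘ inj₁ ∷ [])
               ∷ ((vx ∘ inj₁ ∘ sym) ∷ x≢y ∷ [])
               ∷ (vy ∘ inj₁ ∷ []) ∷ [] ∷ []
    ; last~first = G.~-sym (adjacent uy) })
    where
    adjacent : ∀ {a b} → ¬ Near G̅ a b → a G.~ b
    adjacent {a} {b} far with a G.~? b
    ... | yes a~b = a~b
    ... | no a≁b = contradiction (inj₂ (far ∘ inj₁ , a≁b)) far

  -- Every edge has a colour of its own, the position of its increasing form in `otherPairs`; the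
  -- same list, with proofs attached, is the clique.
  cotree-certificate : Certificate G̅ (((m ∸ 1) * (m ∸ 2)) / 2)
  cotree-certificate = subst (Certificate G̅) length-otherPairs record
    { colouring = record
      { colour      = λ e → Any.index (proj₁ (proj₂ (normalise e)))
      ; well-formed = wf
      ; separates   = sep
      }
    ; clique    = proj₁ lifted
    ; isClique  = AllPairs.map (λ {e} {f} e≁f → e≁f , complement-close e f)
                    (AllPairs.map⁻ (subst (AllPairs (λ p q → ¬ SamePair p q)) (sym (proj₂ lifted)) distinct))
    ; size      = trans (sym (length-map proj₁ (proj₁ lifted))) (cong length (proj₂ lifted))
    }
    where
    other-increasing : ∀ {p} → p ∈ otherPairs → proj₁ p Data.Fin.< proj₂ p
    other-increasing p∈ = increasing (proj₁ (∈-filter⁻ (¬? ∘ adjacent?) {xs = increasingPairs m} p∈))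

    unique : Unique otherPairs
    unique = Unique.filter⁺ (¬? ∘ adjacent?) (increasingPairs-unique m)

    distinct : AllPairs (λ p q → ¬ SamePair p q) otherPairs
    distinct = increasing-distinct other-increasing unique

    lifted : ∃[ edges ] map (proj₁ {B = λ (u , v) → Graph._~_ G̅ u v}) edges ≡ otherPairs
    lifted = lift-All (All.tabulate λ {(u , v)} p∈ →
      (λ { refl → ℕ.<-irrefl refl (other-increasing p∈) }) ,
      proj₂ (∈-filter⁻ (¬? ∘ adjacent?) {xs = increasingPairs m} p∈))

    same-index : ∀ {p q} (p∈ : p ∈ otherPairs) (q∈ : q ∈ otherPairs) → SamePair p q → Any.index p∈ ≡ Any.index q∈
    same-index p∈ q∈ (inj₁ (refl , refl)) = cong Any.index (unique⇒irrelevant unique p∈ q∈)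
    same-index p∈ q∈ (inj₂ (refl , refl)) = contradiction (other-increasing q∈) (ℕ.<-asym (other-increasing p∈))

    wf : ∀ e f → SameEdge G̅ e f → Any.index (proj₁ (proj₂ (normalise e))) ≡ Any.index (proj₁ (proj₂ (normalise f)))
    wf e f s with _ , p∈ , e~p ← normalise e | _ , q∈ , f~q ← normalise f =
      same-index p∈ q∈ (samePair-trans (samePair-sym e~p) (samePair-trans s f~q))

    sep : ∀ e f → Conflict G̅ e f → Any.index (proj₁ (proj₂ (normalise e))) ≢ Any.index (proj₁ (proj₂ (normalise f)))
    sep e f (e≁f , _) eq with p , p∈ , e~p ← normalise e | _ , q∈ , f~q ← normalise f
      with refl ← trans (lookup-index p∈) (trans (cong (lookup otherPairs) eq) (sym (lookup-index q∈))) =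
      e≁f (samePair-trans {q = p} e~p (samePair-sym {p = proj₁ f} f~q))

-- The program

-- Cells below top hold the stack of pairs of a vertex count and an index, in
-- place of input that has already been read. The degrees of each leaf are
-- counted in cells from base onwards that have not been written to before.

pattern len  = 0F
pattern pos  = 1F
pattern top  = 2F
pattern base = 3F
pattern todo = 4F
pattern one  = 5F
pattern tag  = 6F
pattern size = 7F
pattern idx  = 8F
pattern cnt  = 9F
pattern tmp  = suc 9F
pattern aux  = suc (suc 9F)

incr decr : Fin 12 → Program 12
incr x = x ≔ x ⟨ add ⟩ one
decr x = x ≔ x ⟨ sub ⟩ one

-- `idx` counts the remaining words down to zero, and this zero is the initial maximum for
-- `maximise`.
countDegrees : Program 12
countDegrees = whileNonzero idx
  ( tmp ≔mem[ pos ] ⨾ tmp ≔ base ⟨ add ⟩ tmp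
  ⨾ aux ≔mem[ tmp ] ⨾ incr aux ⨾ mem[ tmp ]≔ aux
  ⨾ incr pos ⨾ decr idx )

maximise : Program 12
maximise = whileNonzero cnt
  ( tmp ≔mem[ tag ] ⨾ tmp ≔ base ⟨ add ⟩ tmp ⨾ tmp ≔mem[ tmp ] ⨾ incr tag
  ⨾ aux ≔mem[ tag ] ⨾ aux ≔ base ⟨ add ⟩ aux ⨾ aux ≔mem[ aux ] ⨾ incr tag
  ⨾ tmp ≔ tmp ⟨ add ⟩ aux ⨾ decr tmp
  -- Truncated subtraction leaves the larger of the old maximum and the weight in `idx`.
  ⨾ tmp ≔ tmp ⟨ sub ⟩ idx ⨾ idx ≔ idx ⟨ add ⟩ tmp
  ⨾ decr cnt )

-- On entry tag is 0 and becomes a second reading position.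
readTree : Program 12
readTree = tag ≔ pos ⟨ add ⟩ tag ⨾ idx ≔ cnt ⟨ add ⟩ cnt ⨾ countDegrees ⨾ maximise

-- Only the number of vertices matters, so the two words of each of the `cnt` edges are skipped.
readCotree : Program 12
readCotree = pos ≔ pos ⟨ add ⟩ cnt ⨾ pos ≔ pos ⟨ add ⟩ cnt
  ⨾ tmp ≔ cnt ⟨ sub ⟩ one ⨾ idx ≔ cnt ⟨ mul ⟩ tmp ⨾ tmp ≔# 2 ⨾ idx ≔ idx ⟨ div ⟩ tmp

-- The input does not state the number of edges, but it is one less than `size`. Moving `base` by
-- `size` gives the next leaf counters that are still zero.
readLeaf : Program 12
readLeaf = size ≔mem[ pos ] ⨾ incr pos ⨾ cnt ≔ size ⟨ sub ⟩ one
  ⨾ ifNonzero tag readCotree readTree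
  ⨾ base ≔ base ⟨ add ⟩ size

combineJoin combineUnion combineNode : Program 12
combineJoin  = aux ≔ size ⟨ mul ⟩ cnt ⨾ tmp ≔ tmp ⟨ add ⟩ aux ⨾ idx ≔ idx ⟨ add ⟩ tmp
-- Truncated subtraction makes this the maximum.
combineUnion = tmp ≔ tmp ⟨ sub ⟩ idx ⨾ idx ≔ idx ⟨ add ⟩ tmp
combineNode  = decr top ⨾ tmp ≔mem[ top ] ⨾ decr top ⨾ cnt ≔mem[ top ]
  ⨾ decr top ⨾ idx ≔mem[ top ] ⨾ decr top ⨾ size ≔mem[ top ]
  -- `aux` already holds the tag less one; now it becomes zero for a union and one for a join.
  ⨾ decr aux ⨾ ifNonzero aux combineJoin combineUnion
  ⨾ size ≔ size ⟨ add ⟩ cnt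

pushResult : Program 12
pushResult = mem[ top ]≔ size ⨾ incr top ⨾ mem[ top ]≔ idx ⨾ incr top ⨾ todo ≔ len ⟨ sub ⟩ pos

step : Program 12
-- Truncation sends both leaf tags to zero.
step = tag ≔mem[ pos ] ⨾ incr pos ⨾ aux ≔ tag ⟨ sub ⟩ one
  ⨾ ifNonzero aux combineNode readLeaf ⨾ pushResult

main : Program 12
-- `top` is still zero, so adding it copies `len`.
main = (base ≔ len ⟨ add ⟩ top ⨾ todo ≔ len ⟨ add ⟩ top ⨾ one ≔# 1)
  -- The one remaining pair fills cells 0 and 1, so its index is at the address held by `one`.
  ⨾ whileNonzero todo step ⨾ len ≔mem[ one ]

-- Executions

infix 4 _⊢_∶_⇓≤[_]_

_⊢_∶_⇓≤[_]_ : ℕ → Program 12 → State 12 → ℕ → State 12 → Set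
W ⊢ P ∶ s ⇓≤[ b ] s′ = ∃[ t ] t ≤ b × (W ⊢ P ∶ s ⇓[ t ] s′)

infixr 5 _▹_ _▹≤_

_▹_ : ∀ {W} {P Q : Program 12} {s s′ s″ t u} →
      W ⊢ P ∶ s ⇓[ t ] s′ → W ⊢ Q ∶ s′ ⇓[ u ] s″ → W ⊢ P ⨾ Q ∶ s ⇓[ t + u ] s″
_▹_ = seq

_▹≤_ : ∀ {W P Q s s′ s″ b c} →
       W ⊢ P ∶ s ⇓≤[ b ] s′ → W ⊢ Q ∶ s′ ⇓≤[ c ] s″ → W ⊢ P ⨾ Q ∶ s ⇓≤[ b + c ] s″
(_ , t≤ , p) ▹≤ (_ , u≤ , q) = _ , ℕ.+-mono-≤ t≤ u≤ , seq p q

exactly : ∀ {W P s s′ t} → W ⊢ P ∶ s ⇓[ t ] s′ → W ⊢ P ∶ s ⇓≤[ t ] s′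
exactly p = _ , ℕ.≤-refl , p

relax : ∀ {W P s s′ b c} → b ≤ c → W ⊢ P ∶ s ⇓≤[ b ] s′ → W ⊢ P ∶ s ⇓≤[ c ] s′
relax b≤c (_ , t≤ , p) = _ , ℕ.≤-trans t≤ b≤c , p

-- The equation lets the next state show the value in simplified form, such as `suc n` for `n + 1`.
load′ : ∀ {W} {R : Vec ℕ 12} {M x a v} → M (Vec.lookup R a) ≡ v → v < W →
        W ⊢ x ≔mem[ a ] ∶ ⟨ R , M ⟩ ⇓[ 1 ] ⟨ R [ x ]≔ v , M ⟩
load′ refl = load

op′ : ∀ {W} {R : Vec ℕ 12} {M x y o z v} → apply o (Vec.lookup R y) (Vec.lookup R z) ≡ v → v < W →
      W ⊢ x ≔ y ⟨ o ⟩ z ∶ ⟨ R , M ⟩ ⇓[ 1 ] ⟨ R [ x ]≔ v , M ⟩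
op′ refl = op

Memory : Set
Memory = ℕ → ℕ

update-≡ : ∀ (M : Memory) a {x} → (M [ a ↦ x ]) a ≡ x
update-≡ M a {x} = cong (λ b → if b then x else M a) (dec-true (a ≟ a) refl)

update-≢ : ∀ (M : Memory) a {x i} → i ≢ a → (M [ a ↦ x ]) i ≡ M i
update-≢ M a {x} {i} i≢a = cong (λ b → if b then x else M i) (dec-false (i ≟ a) i≢a)

AgreeBelow : ℕ → Memory → Memory → Set
AgreeBelow k M M′ = ∀ i → i < k → M′ i ≡ M i

data Holds (M : Memory) : ℕ → List ℕ → Set where
  []  : ∀ {p} → Holds M p []
  _∷_ : ∀ {p w ws} → M p ≡ w → Holds M (suc p) ws → Holds M p (w ∷ ws)

holds-frame : ∀ {M M′ p ws} → (∀ i → p ≤ i → i < p + length ws → M′ i ≡ M i) → Holds M p ws → Holds M′ p ws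
holds-frame agree [] = []
holds-frame {p = p} {_ ∷ ws} agree (eq ∷ h) =
  trans (agree p ℕ.≤-refl (ℕ.m<m+n p (s≤s z≤n))) eq ∷
  holds-frame (λ i p<i i< → agree i (ℕ.<⇒≤ p<i) (subst (i <_) (sym (ℕ.+-suc p (length ws))) i<)) h

holds-++⁻ : ∀ {M p} vs {ws} → Holds M p (vs ++ ws) → Holds M p vs × Holds M (p + length vs) ws
holds-++⁻ {M} {p} [] {ws} h = [] , subst (λ q → Holds M q ws) (sym (ℕ.+-identityʳ p)) h
holds-++⁻ {M} {p} (_ ∷ vs) {ws} (eq ∷ h) with h₁ , h₂ ← holds-++⁻ vs h =
  eq ∷ h₁ , subst (λ q → Holds M q ws) (sym (ℕ.+-suc p (length vs))) h₂

data Stack (M : Memory) : ℕ → List (ℕ × ℕ) → Set where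
  empty : Stack M 0 []
  push  : ∀ {k n s st} → Stack M k st → M k ≡ n → M (suc k) ≡ s → Stack M (2 + k) ((n , s) ∷ st)

stack-frame : ∀ {M M′ k st} → AgreeBelow k M M′ → Stack M k st → Stack M′ k st
stack-frame agree empty = empty
stack-frame agree (push {k} st n s) =
  push (stack-frame (λ i i<k → agree i (ℕ.m≤n⇒m≤1+n (ℕ.m≤n⇒m≤1+n i<k))) st)
       (trans (agree k (ℕ.m≤n⇒m≤1+n ℕ.≤-refl)) n) (trans (agree (suc k) ℕ.≤-refl) s)

regs : (L p k D r t n s c u v : ℕ) → Vec ℕ 12
regs L p k D r t n s c u v = L ∷ p ∷ k ∷ D ∷ r ∷ 1 ∷ t ∷ n ∷ s ∷ c ∷ u ∷ v ∷ []

+1 : ∀ n → n + 1 ≡ suc n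
+1 n = ℕ.+-comm n 1

m+[n∸m]≡m⊔n : ∀ m n → m + (n ∸ m) ≡ m ⊔ n
m+[n∸m]≡m⊔n m n with ℕ.≤-total m n
... | inj₁ m≤n = trans (ℕ.m+[n∸m]≡n m≤n) (sym (ℕ.m≤n⇒m⊔n≡n m≤n))
... | inj₂ n≤m = trans (cong (m +_) (ℕ.m≤n⇒m∸n≡0 n≤m)) (trans (ℕ.+-identityʳ m) (sym (ℕ.m≥n⇒m⊔n≡m n≤m)))

-- The initial counts `g` are arbitrary because the recursive call starts with counters already
-- raised. The bound `g i + length ws < W` is kept, as each word raises a counter by at most one and
-- shortens the list by one.
count-run : ∀ {W L k D r t n c u v p q M} (g : ℕ → ℕ) ws →
  Holds M p ws → p + length ws ≡ q → q ≤ D → D < W →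
  (∀ i → M (D + i) ≡ g i) → All (λ w → D + w < W) ws →
  (∀ i → g i + length ws < W) →
  ∃[ u′ ] ∃[ v′ ] ∃[ M′ ]
    (W ⊢ countDegrees ∶ ⟨ regs L p k D r t n (length ws) c u v , M ⟩ ⇓[ length ws * 8 + 1 ]
                        ⟨ regs L q k D r t n 0 c u′ v′ , M′ ⟩) ×
    (∀ i → M′ (D + i) ≡ g i + occurrences i ws) × AgreeBelow D M M′
count-run {p = p} g [] _ refl _ _ deg _ _ rewrite ℕ.+-identityʳ p =
  _ , _ , _ , while-zero refl , (λ i → trans (deg i) (sym (ℕ.+-identityʳ (g i)))) , λ _ _ → refl
count-run {W} {D = D} {p = p} {q} {M} g (w ∷ ws) (Mp ∷ h) eq q≤D D<W deg (Dw<W ∷ fits) bound =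
  let u′ , v′ , M″ , run , deg″ , agree = rest in
  u′ , v′ , M″ ,
  while-nonzero (λ ())
    ( load′ Mp (ℕ.≤-<-trans (ℕ.m≤n+m w D) Dw<W)
    ▹ op Dw<W
    ▹ load′ (deg w) (ℕ.≤-<-trans (ℕ.m≤m+n (g w) _) (bound w))
    ▹ op′ (+1 (g w)) (ℕ.≤-<-trans suc-g≤ (bound w))
    ▹ store
    ▹ op′ (+1 p) (ℕ.≤-<-trans p<D D<W)
    ▹ op (ℕ.≤-<-trans (ℕ.≤-trans (ℕ.n≤1+n _) (ℕ.m≤n+m _ (g 0))) (bound 0)) )
    run ,
  (λ i → trans (deg″ i) (shuffle i)) ,
  λ i i<D → trans (agree i i<D) (below i<D)
  where
  eq′ : suc p + length ws ≡ q
  eq′ = trans (sym (ℕ.+-suc p (length ws))) eq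

  p<D : p < D
  p<D = ℕ.<-≤-trans (subst (p <_) eq (ℕ.m<m+n p (s≤s z≤n))) q≤D

  below : ∀ {i} → i < D → (M [ D + w ↦ suc (g w) ]) i ≡ M i
  below i<D = update-≢ M (D + w) (ℕ.<⇒≢ (ℕ.<-≤-trans i<D (ℕ.m≤m+n D w)))

  deg′ : ∀ i → (M [ D + w ↦ suc (g w) ]) (D + i) ≡ indicator (i ≟ w) + g i
  deg′ i with i ≟ w
  ... | yes refl = trans (update-≡ M (D + i)) (cong (λ b → (if b then 1 else 0) + g i) (sym (dec-true (i ≟ i) refl)))
  ... | no i≢w = trans (trans (update-≢ M (D + w) (i≢w ∘ ℕ.+-cancelˡ-≡ D i w)) (deg i))
                       (cong (λ b → (if b then 1 else 0) + g i) (sym (dec-false (i ≟ w) i≢w)))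

  indicator≤1 : ∀ i → indicator (i ≟ w) ≤ 1
  indicator≤1 i with does (i ≟ w)
  ... | true  = s≤s z≤n
  ... | false = z≤n

  bump : ∀ i → indicator (i ≟ w) + g i + length ws ≤ g i + suc (length ws)
  bump i = subst (indicator (i ≟ w) + g i + length ws ≤_) (sym (ℕ.+-suc (g i) (length ws)))
             (ℕ.+-monoˡ-≤ (length ws) (ℕ.+-monoˡ-≤ (g i) (indicator≤1 i)))

  suc-g≤ : suc (g w) ≤ g w + suc (length ws)
  suc-g≤ = subst (suc (g w) ≤_) (sym (ℕ.+-suc (g w) (length ws))) (s≤s (ℕ.m≤m+n (g w) _))

  shuffle : ∀ i → indicator (i ≟ w) + g i + occurrences i ws ≡ g i + (indicator (i ≟ w) + occurrences i ws)
  shuffle i = trans (cong (_+ occurrences i ws) (ℕ.+-comm (indicator (i ≟ w)) (g i))) (ℕ.+-assoc (g i) _ _)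

  rest = count-run {p = suc p} {M = M [ D + w ↦ suc (g w) ]}
    (λ i → indicator (i ≟ w) + g i) ws
    (holds-frame (λ i _ i< → below (ℕ.<-≤-trans (subst (i <_) eq′ i<) q≤D)) h) eq′ q≤D D<W deg′ fits
    (λ i → ℕ.≤-<-trans (bump i) (bound i))

maximise-run : ∀ {m W L p k D r n u v a M} (g : ℕ → ℕ) s (es : List (Fin m × Fin m)) →
  Holds M a (edgeWords es) → a + length (edgeWords es) ≤ D → D + m < W →
  (∀ i → M (D + i) ≡ g i) → (∀ i j → g i + g j < W) → s < W → length es < W →
  ∃[ a′ ] ∃[ u′ ] ∃[ v′ ]
    (W ⊢ maximise ∶ ⟨ regs L p k D r a n s (length es) u v , M ⟩ ⇓[ length es * 14 + 1 ]
                    ⟨ regs L p k D r a′ n (s ⊔ heaviest g es) 0 u′ v′ , M ⟩)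
maximise-run g s [] _ _ _ _ _ _ _ rewrite ℕ.⊔-identityʳ s = _ , _ , _ , while-zero refl
maximise-run {m} {W} {D = D} {a = a} {M} g s (e@(x , y) ∷ es) (Ma ∷ Ma′ ∷ h) room fits deg bound s<W es<W =
  let a′ , u′ , v′ , run = rest in
  a′ , u′ , v′ , subst (λ z → W ⊢ maximise ∶ _ ⇓[ _ ] ⟨ regs _ _ _ _ _ a′ _ z 0 u′ v′ , M ⟩)
    (ℕ.⊔-assoc s (weight g e) (heaviest g es))
    (while-nonzero (λ ())
      ( load′ Ma (ℕ.≤-<-trans (ℕ.m≤n+m _ D) (vertex x))
      ▹ op (vertex x)
      ▹ load′ (deg (toℕ x)) (ℕ.≤-<-trans (ℕ.m≤m+n _ _) (bound (toℕ x) 0))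
      ▹ op′ (+1 a) (small (s≤s (ℕ.m≤n⇒m≤1+n (ℕ.m≤m+n a _))))
      ▹ load′ Ma′ (ℕ.≤-<-trans (ℕ.m≤n+m _ D) (vertex y))
      ▹ op (vertex y)
      ▹ load′ (deg (toℕ y)) (ℕ.≤-<-trans (ℕ.m≤m+n _ _) (bound (toℕ y) 0))
      ▹ op′ (+1 (suc a)) (small (s≤s (s≤s (ℕ.m≤m+n a _))))
      ▹ op (bound (toℕ x) (toℕ y))
      ▹ op weight<W
      ▹ op (ℕ.≤-<-trans (ℕ.m∸n≤m _ s) weight<W)
      ▹ op′ (m+[n∸m]≡m⊔n s (weight g e)) (ℕ.⊔-pres-<m s<W weight<W)
      ▹ op (ℕ.≤-<-trans (ℕ.n≤1+n _) es<W) )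
      run)
  where
  room′ : suc (suc a) + length (edgeWords es) ≤ D
  room′ = subst (_≤ D) (trans (ℕ.+-suc a _) (cong suc (ℕ.+-suc a _))) room

  small : ∀ {z} → z ≤ suc (suc a) + length (edgeWords es) → z < W
  small z≤ = ℕ.≤-<-trans (ℕ.≤-trans z≤ room′) (ℕ.≤-<-trans (ℕ.m≤m+n D m) fits)

  vertex : (z : Fin m) → D + toℕ z < W
  vertex z = ℕ.<-trans (ℕ.+-monoʳ-< D (Fin.toℕ<n z)) fits

  weight<W : weight g e < W
  weight<W = ℕ.≤-<-trans (ℕ.m∸n≤m _ 1) (bound (toℕ x) (toℕ y))

  rest = maximise-run {a = suc (suc a)} g (s ⊔ weight g e) es h room′ fits deg bound
           (ℕ.⊔-pres-<m s<W weight<W) (ℕ.≤-<-trans (ℕ.n≤1+n _) es<W)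

infixr 5 _▸_

_▸_ : ∀ {W} {P Q : Program 12} {s s′ s″ t b} →
      W ⊢ P ∶ s ⇓[ t ] s′ → W ⊢ Q ∶ s′ ⇓≤[ b ] s″ → W ⊢ P ⨾ Q ∶ s ⇓≤[ t + b ] s″
p ▸ q = exactly p ▹≤ q

if-nonzero≤ : ∀ {W x} {P Q : Program 12} {R M s′ b} → Vec.lookup R x ≢ 0 →
              W ⊢ P ∶ ⟨ R , M ⟩ ⇓≤[ b ] s′ → W ⊢ ifNonzero x P Q ∶ ⟨ R , M ⟩ ⇓≤[ suc b ] s′
if-nonzero≤ x≢0 (_ , t≤ , p) = _ , s≤s t≤ , if-nonzero x≢0 p

if-zero≤ : ∀ {W x} {P Q : Program 12} {R M s′ b} → Vec.lookup R x ≡ 0 →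
           W ⊢ Q ∶ ⟨ R , M ⟩ ⇓≤[ b ] s′ → W ⊢ ifNonzero x P Q ∶ ⟨ R , M ⟩ ⇓≤[ suc b ] s′
if-zero≤ x≡0 (_ , t≤ , p) = _ , s≤s t≤ , if-zero x≡0 p

length-edgeWords : ∀ {m} (es : List (Fin m × Fin m)) → length (edgeWords es) ≡ length es + length es
length-edgeWords [] = refl
length-edgeWords (_ ∷ es) = cong suc (trans (cong suc (length-edgeWords es)) (sym (ℕ.+-suc (length es) (length es))))

edgeWords-bounded : ∀ {m} (es : List (Fin m × Fin m)) → All (_< m) (edgeWords es)
edgeWords-bounded [] = []
edgeWords-bounded ((u , v) ∷ es) = Fin.toℕ<n u ∷ Fin.toℕ<n v ∷ edgeWords-bounded es

occurrences≤length : ∀ i ws → occurrences i ws ≤ length ws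
occurrences≤length i [] = z≤n
occurrences≤length i (w ∷ ws) with does (i ≟ w)
... | true  = s≤s (occurrences≤length i ws)
... | false = ℕ.m≤n⇒m≤1+n (occurrences≤length i ws)

occurrences-above : ∀ {m i ws} → All (_< m) ws → m ≤ i → occurrences i ws ≡ 0
occurrences-above [] _ = refl
occurrences-above {i = i} {w ∷ ws} (w<m ∷ ws<m) m≤i =
  trans (cong (λ b → (if b then 1 else 0) + occurrences i ws)
          (dec-false (i ≟ w) (λ { refl → ℕ.<⇒≱ w<m m≤i })))
        (occurrences-above ws<m m≤i)

vertexCount : DecompositionTree → ℕ
vertexCount (treeLeaf {m} _ _)   = m
vertexCount (cotreeLeaf {m} _ _) = m
vertexCount (unionNode S T)      = vertexCount S + vertexCount T
vertexCount (joinNode S T)       = vertexCount S + vertexCount T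

-- Defined on the encoding because the index of a tree leaf is read off its listed edges.
index : ∀ {ws T} → ws Encodes T → ℕ
index (treeLeaf {es = es} _)            = treeIndex es
index (cotreeLeaf {m} _)                = ((m ∸ 1) * (m ∸ 2)) / 2
index (unionNode s t)                   = index s ⊔ index t
index (joinNode {S} {T} s t)            = index s + (index t + vertexCount S * vertexCount T)

-- Single iterations of the main loop

module Simulation (W B L : ℕ) (4≤B : 4 ≤ B) (fits : ∀ {x} → x ≤ B * B → x < W) where

  word : ∀ {x} → x ≤ B → x < W
  word x≤B = fits (ℕ.≤-trans x≤B (ℕ.m≤m*n B B {{>-nonZero (ℕ.≤-trans (s≤s z≤n) 4≤B)}}))

  -- The loop invariant. `k≤p` keeps the stack off the unread input, `L≤D` keeps the counters off
  -- both, and `zeros` supplies fresh counters.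
  record Config (st : List (ℕ × ℕ)) (input : List ℕ) : Set where
    field
      p k D t n s c u v : ℕ
      M       : Memory
      stack   : Stack M k st
      unread  : Holds M p input
      k≤p     : k ≤ p
      end     : p + length input ≡ L
      L≤D     : L ≤ D
      zeros   : ∀ i → D ≤ i → M i ≡ 0

    state : State 12
    state = ⟨ regs L p k D (length input) t n s c u v , M ⟩

  open Config using (state)

  abstract
    -- The room `2 + k ≤ p` for the new pair comes from the tag and the size of a leaf, or from the
    -- pairs that a node pops.
    pushed : ∀ {st rest p k D r t n s c u v M} →
             Stack M k st → Holds M p rest → 2 + k ≤ p → p + length rest ≡ L → L ≤ D → D ≤ B →
             (∀ i → D ≤ i → M i ≡ 0) →
             Σ (Config ((n , s) ∷ st) rest) λ C → Config.D C ≡ D ×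
               (W ⊢ pushResult ∶ ⟨ regs L p k D r t n s c u v , M ⟩ ⇓[ 5 ] state C)
    pushed {st} {rest} {p} {k} {D} {n = n} {s} {M = M} stk inp 2+k≤p end L≤D D≤B zeros =
      record
        { stack  = push (stack-frame (λ i i<k → low i (ℕ.<⇒≢ i<k) (ℕ.<⇒≢ (ℕ.m≤n⇒m≤1+n i<k))) stk)
                     (trans (update-≢ (M [ k ↦ n ]) (suc k) (ℕ.<⇒≢ ℕ.≤-refl)) (update-≡ M k))
                     (update-≡ (M [ k ↦ n ]) (suc k))
        ; unread = holds-frame (λ i p≤i _ → high i (ℕ.≤-trans 2+k≤p p≤i)) inp
        ; k≤p    = 2+k≤p
        ; end    = end
        ; L≤D    = L≤D
        ; zeros  = λ i D≤i → trans (high i (ℕ.≤-trans 2+k≤p (ℕ.≤-trans p≤D D≤i))) (zeros i D≤i)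
        } ,
      refl ,
      ( store
      ▹ op′ (+1 k) (word (ℕ.≤-trans (ℕ.n≤1+n _) 2+k≤B))
      ▹ store
      ▹ op′ (+1 (suc k)) (word 2+k≤B)
      ▹ op′ remaining (word (ℕ.≤-trans (subst (length rest ≤_) end (ℕ.m≤n+m _ p)) (ℕ.≤-trans L≤D D≤B))) )
      where
      M′ : Memory
      M′ = (M [ k ↦ n ]) [ suc k ↦ s ]

      low : ∀ i → i ≢ k → i ≢ suc k → M′ i ≡ M i
      low i i≢k i≢1+k = trans (update-≢ (M [ k ↦ n ]) (suc k) i≢1+k) (update-≢ M k i≢k)

      high : ∀ i → 2 + k ≤ i → M′ i ≡ M i
      high i le = low i (ℕ.>⇒≢ (ℕ.<⇒≤ le)) (ℕ.>⇒≢ le)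

      p≤D : p ≤ D
      p≤D = ℕ.≤-trans (subst (p ≤_) end (ℕ.m≤m+n p _)) L≤D

      2+k≤B : 2 + k ≤ B
      2+k≤B = ℕ.≤-trans 2+k≤p (ℕ.≤-trans p≤D D≤B)

      remaining : L ∸ p ≡ length rest
      remaining = trans (cong (_∸ p) (sym end)) (ℕ.m+n∸m≡n p (length rest))

  abstract
    -- Both kinds of node differ only in `combine`. The 23 steps are three before the first test,
    -- the test, nine to pop two pairs and lower `aux`, four to combine, one for the size and five
    -- to push.
    node : ∀ {st rest w n₁ n₂ s₁ s₂ f} (C : Config ((n₂ , s₂) ∷ (n₁ , s₁) ∷ st) (2 + w ∷ rest)) →
           2 + w ≤ B → Config.D C ≤ B → n₁ + n₂ ≤ B → s₁ < W → s₂ < W →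
           (∀ {p k D r t M} → ∃[ u ] ∃[ v ] (W ⊢ ifNonzero aux combineJoin combineUnion ∶
               ⟨ regs L p k D r t n₁ s₁ n₂ s₂ w , M ⟩ ⇓≤[ 4 ] ⟨ regs L p k D r t n₁ f n₂ u v , M ⟩)) →
           Σ (Config ((n₁ + n₂ , f) ∷ st) rest) λ C′ → Config.D C′ ≡ Config.D C ×
             (W ⊢ step ∶ state C ⇓≤[ 23 ] state C′)
    node {rest = rest} {w} {n₁} {n₂} C w≤B D≤B n≤B s₁<W s₂<W combine with Config.stack C | Config.unread C | Config.k≤p C
    ... | push (push {k} stk n₁≡ s₁≡) n₂≡ s₂≡ | w≡ ∷ inp | k≤p =
      let u , v , run = combine
          C′ , D≡ , end-run = pushed {c = n₂} {u = u} {v = v} stk inp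
            (ℕ.m≤n⇒m≤1+n (ℕ.≤-trans (ℕ.n≤1+n _) (ℕ.≤-trans (ℕ.n≤1+n _) k≤p))) end′ C.L≤D D≤B C.zeros
      in C′ , D≡ ,
      ( load′ w≡ (word w≤B)
      ▸ op′ (+1 C.p) (word (ℕ.≤-trans p<L L≤B))
      ▸ op (word (ℕ.≤-trans (ℕ.n≤1+n _) w≤B))
      ▸ if-nonzero≤ (λ ())
          ( op (word (below (3 + k) ℕ.≤-refl))
          ▸ load′ s₂≡ s₂<W
          ▸ op (word (below (2 + k) (ℕ.n≤1+n _)))
          ▸ load′ n₂≡ (word (ℕ.≤-trans (ℕ.m≤n+m n₂ n₁) n≤B))
          ▸ op (word (below (1 + k) (ℕ.≤-trans (ℕ.n≤1+n _) (ℕ.n≤1+n _))))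
          ▸ load′ s₁≡ s₁<W
          ▸ op (word (below k (ℕ.≤-trans (ℕ.n≤1+n _) (ℕ.≤-trans (ℕ.n≤1+n _) (ℕ.n≤1+n _)))))
          ▸ load′ n₁≡ (word (ℕ.≤-trans (ℕ.m≤m+n n₁ n₂) n≤B))
          ▸ op (word (ℕ.≤-trans (ℕ.n≤1+n _) (ℕ.≤-trans (ℕ.n≤1+n _) w≤B)))
          ▸ run
          ▹≤ exactly (op (word n≤B)) )
      ▹≤ exactly end-run )
      where
      module C = Config C
      end′ : suc C.p + length rest ≡ L
      end′ = trans (sym (ℕ.+-suc C.p _)) C.end

      p<L : C.p < L
      p<L = subst (C.p <_) C.end (ℕ.m<m+n C.p (s≤s z≤n))

      L≤B : L ≤ B
      L≤B = ℕ.≤-trans C.L≤D D≤B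

      below : ∀ i → i ≤ 3 + k → i ≤ B
      below i i≤ = ℕ.≤-trans i≤ (ℕ.≤-trans (ℕ.n≤1+n _) (ℕ.≤-trans k≤p (ℕ.≤-trans (ℕ.<⇒≤ p<L) L≤B)))

  module Leaf {st m w} (es : List (Fin m × Fin m)) (rest : List ℕ)
              (C : Config st (w ∷ m ∷ edgeWords es ++ rest)) (count : suc (length es) ≡ m)
              (fitting : Config.D C + m ≤ B) where
    module C = Config C
    ws = edgeWords es
    q = 2 + C.p + length ws

    private
      split : Holds C.M C.p (w ∷ m ∷ ws ++ rest) →
              C.M C.p ≡ w × C.M (suc C.p) ≡ m × Holds C.M (2 + C.p) ws × Holds C.M q rest
      split (eq ∷ eq′ ∷ h) = eq , eq′ , holds-++⁻ ws h

    tag≡ = proj₁ (split C.unread)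
    size≡ = proj₁ (proj₂ (split C.unread))
    edges-held = proj₁ (proj₂ (proj₂ (split C.unread)))
    rest-held = proj₂ (proj₂ (proj₂ (split C.unread)))

    q-end : q + length rest ≡ L
    q-end = begin
      2 + C.p + length ws + length rest     ≡⟨ ℕ.+-assoc (2 + C.p) _ _ ⟩
      2 + C.p + (length ws + length rest)   ≡⟨ cong (2 + C.p +_) (length-++ ws) ⟨
      2 + C.p + length (ws ++ rest)         ≡⟨ cong suc (ℕ.+-suc C.p _) ⟨
      suc C.p + suc (length (ws ++ rest))   ≡⟨ ℕ.+-suc C.p _ ⟨
      C.p + (2 + length (ws ++ rest))       ≡⟨ C.end ⟩
      L                                     ∎
      where open ≡-Reasoning

    q≤D : q ≤ C.D
    q≤D = ℕ.≤-trans (subst (q ≤_) q-end (ℕ.m≤m+n q _)) C.L≤D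

    2+k≤q : 2 + C.k ≤ q
    2+k≤q = ℕ.≤-trans (s≤s (s≤s C.k≤p)) (ℕ.m≤m+n _ _)

    D≤B : C.D ≤ B
    D≤B = ℕ.≤-trans (ℕ.m≤m+n C.D m) fitting

    m≤B : m ≤ B
    m≤B = ℕ.≤-trans (ℕ.m≤n+m m C.D) fitting

    q≤B : q ≤ B
    q≤B = ℕ.≤-trans q≤D D≤B

    2+p≤B : 2 + C.p ≤ B
    2+p≤B = ℕ.≤-trans (ℕ.m≤m+n (2 + C.p) _) q≤B

    edges≤B : length es ≤ B
    edges≤B = ℕ.≤-trans (ℕ.n≤1+n _) (subst (_≤ B) (sym count) m≤B)

    words≤B : length ws ≤ B
    words≤B = ℕ.≤-trans (ℕ.m≤n+m (length ws) (2 + C.p)) q≤B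

    pred-m : m ∸ 1 ≡ length es
    pred-m = cong (_∸ 1) (sym count)

    q-split : 2 + C.p + length es + length es ≡ q
    q-split = trans (ℕ.+-assoc (2 + C.p) _ _) (cong (2 + C.p +_) (sym (length-edgeWords es)))

    at-least : ∀ {k} → k ≤ 70 → k + length es * 30 ≤ m * 70
    at-least {k} k≤70 = begin
      k + length es * 30   ≤⟨ ℕ.+-mono-≤ k≤70 (ℕ.*-monoʳ-≤ (length es) (ℕ.m≤m+n 30 40)) ⟩
      suc (length es) * 70 ≡⟨ cong (λ n → n * 70) {suc (length es)} {m} count ⟩
      m * 70               ∎
      where open ℕ.≤-Reasoning

    -- An edge takes 16 steps to count its two ends and 14 in the maximum. The constant part
    -- includes the loop test, which `tree-leaf` subtracts again.
    tree-time : 11 + (length ws * 8 + 1 + (length es * 14 + 1)) + 1 + 5 ≤ m * 70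
    tree-time = begin
      11 + (length ws * 8 + 1 + (length es * 14 + 1)) + 1 + 5
        ≡⟨ cong (λ l → 11 + (l * 8 + 1 + (length es * 14 + 1)) + 1 + 5) (length-edgeWords es) ⟩
      11 + ((length es + length es) * 8 + 1 + (length es * 14 + 1)) + 1 + 5
        ≡⟨ solve 1 (λ e → con 11 :+ ((e :+ e) :* con 8 :+ con 1 :+ (e :* con 14 :+ con 1)) :+ con 1 :+ con 5
                       := con 19 :+ e :* con 30) refl (length es) ⟩
      19 + length es * 30                                     ≤⟨ at-least (ℕ.m≤m+n 19 51) ⟩
      m * 70                                                  ∎
      where
      open ℕ.≤-Reasoning
      open +-*-Solver

  abstract
    tree-leaf : ∀ {st m} (es : List (Fin m × Fin m)) rest (C : Config st (0 ∷ m ∷ edgeWords es ++ rest)) →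
                suc (length es) ≡ m → Config.D C + m ≤ B →
                Σ (Config ((m , treeIndex es) ∷ st) rest) λ C′ → Config.D C′ ≡ Config.D C + m ×
                  (W ⊢ step ∶ state C ⇓≤[ m * 70 ∸ 1 ] state C′)
    tree-leaf {m = m} es rest C count fitting =
      let u , v , M′ , run , deg , agree = count-run {W} {L} {C.k} {C.D} {t = 2 + C.p} {m} {length es} {C.u} {0}
              (λ _ → 0) ws edges-held refl q≤D
              (word D≤B) (λ i → C.zeros (C.D + i) (ℕ.m≤m+n C.D i))
              (All.map (λ w<m → word (ℕ.≤-trans (ℕ.<⇒≤ (ℕ.+-monoʳ-< C.D w<m)) fitting)) (edgeWords-bounded es))
              (λ _ → word words≤B)
          -- Counting writes only to cells from `C.D` on, which spares the edges to be read again
          -- and the rest of the input.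
          keep = λ {p} {vs} (p≤D : p + length vs ≤ C.D) → holds-frame {C.M} {M′} {p} {vs} (λ i _ i< → agree i (ℕ.<-≤-trans i< p≤D))
          a , u′ , v′ , run′ = maximise-run (λ i → occurrences i ws) 0 es (keep q≤D edges-held) q≤D (word fitting) deg
              degrees<W (word z≤n) (word edges≤B)
          C′ , D≡ , end-run = pushed {n = m} {s = treeIndex es} (stack-frame (λ i i<k → agree i (ℕ.<-≤-trans i<k k≤D)) C.stack)
              (keep (subst (_≤ C.D) (sym q-end) C.L≤D) rest-held) 2+k≤q q-end (ℕ.≤-trans C.L≤D (ℕ.m≤m+n C.D m)) fitting
              (λ i D+m≤i → cleared M′ deg i D+m≤i)
      in C′ , D≡ , relax (ℕ.∸-monoˡ-≤ 1 tree-time)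
      ( load′ tag≡ (word z≤n)
      ▸ op′ (+1 C.p) (word (ℕ.≤-trans (ℕ.n≤1+n _) 2+p≤B))
      ▸ op (word z≤n)
      ▸ if-zero≤ refl
          ( load′ size≡ (word m≤B)
          ▸ op′ (+1 (suc C.p)) (word 2+p≤B)
          ▸ op′ pred-m (word edges≤B)
          ▸ if-zero≤ refl
              ( op′ (ℕ.+-identityʳ (2 + C.p)) (word 2+p≤B)
              ▸ op′ (sym (length-edgeWords es)) (word words≤B)
              ▸ run
              ▸ exactly run′ )
          ▹≤ exactly (op (word fitting)) )
      ▹≤ exactly end-run )
      where
      open Leaf es rest C count fitting

      k≤D : C.k ≤ C.D
      k≤D = ℕ.≤-trans (ℕ.≤-trans (ℕ.n≤1+n _) (ℕ.≤-trans (ℕ.n≤1+n _) 2+k≤q)) q≤D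

      degrees<W : ∀ i j → occurrences i ws + occurrences j ws < W
      degrees<W i j = fits (ℕ.≤-trans (ℕ.+-mono-≤ (ℕ.≤-trans (occurrences≤length i ws) words≤B)
                                                  (ℕ.≤-trans (occurrences≤length j ws) words≤B))
        (ℕ.≤-trans (ℕ.≤-reflexive (cong (B +_) (sym (ℕ.+-identityʳ B)))) (ℕ.*-monoˡ-≤ B (ℕ.≤-trans (s≤s (s≤s z≤n)) 4≤B))))

      -- The words are vertices below `m`, so no counter from `C.D + m` on was raised.
      cleared : ∀ (M′ : Memory) → (∀ i → M′ (C.D + i) ≡ occurrences i ws) → ∀ i → C.D + m ≤ i → M′ i ≡ 0
      cleared M′ deg i D+m≤i = begin
        M′ i                       ≡⟨ cong M′ (ℕ.m+[n∸m]≡n D≤i) ⟨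
        M′ (C.D + (i ∸ C.D))       ≡⟨ deg (i ∸ C.D) ⟩
        occurrences (i ∸ C.D) ws   ≡⟨ occurrences-above (edgeWords-bounded es)
                                        (ℕ.m+n≤o⇒m≤o∸n m (subst (_≤ i) (ℕ.+-comm C.D m) D+m≤i)) ⟩
        0                          ∎
        where
        open ≡-Reasoning
        D≤i : C.D ≤ i
        D≤i = ℕ.≤-trans (ℕ.m≤m+n C.D m) D+m≤i

    cotree-leaf : ∀ {st m} (es : List (Fin m × Fin m)) rest (C : Config st (1 ∷ m ∷ edgeWords es ++ rest)) →
                  suc (length es) ≡ m → Config.D C + m ≤ B →
                  Σ (Config ((m , ((m ∸ 1) * (m ∸ 2)) / 2) ∷ st) rest) λ C′ → Config.D C′ ≡ Config.D C + m ×
                    (W ⊢ step ∶ state C ⇓≤[ m * 70 ∸ 1 ] state C′)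
    cotree-leaf {m = m} es rest C count fitting =
      let C′ , D≡ , end-run = pushed {n = m} {s = ((m ∸ 1) * (m ∸ 2)) / 2} C.stack rest-held 2+k≤q q-end
              (ℕ.≤-trans C.L≤D (ℕ.m≤m+n C.D m)) fitting
              (λ i D+m≤i → C.zeros i (ℕ.≤-trans (ℕ.m≤m+n C.D m) D+m≤i))
      in C′ , D≡ , relax (ℕ.∸-monoˡ-≤ 1 (ℕ.≤-trans (ℕ.m≤m+n 21 _) (at-least (ℕ.m≤m+n 21 49))))
      ( load′ tag≡ (word (ℕ.≤-trans (s≤s z≤n) 4≤B))
      ▸ op′ (+1 C.p) (word (ℕ.≤-trans (ℕ.n≤1+n _) 2+p≤B))
      ▸ op (word z≤n)
      ▸ if-zero≤ refl
          ( load′ size≡ (word m≤B)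
          ▸ op′ (+1 (suc C.p)) (word 2+p≤B)
          ▸ op (word m-1≤B)
          ▸ if-nonzero≤ (λ ())
              ( op′ (cong (2 + C.p +_) pred-m) (word (ℕ.≤-trans (ℕ.m≤m+n _ (length es)) (subst (_≤ B) (sym q-split) q≤B)))
              ▸ op′ (trans (cong (2 + C.p + length es +_) pred-m) q-split) (word q≤B)
              ▸ op′ (ℕ.∸-+-assoc m 1 1) (word (ℕ.≤-trans (ℕ.m∸n≤m m 2) m≤B))
              ▸ op product<W
              ▸ const (word (ℕ.≤-trans (s≤s (s≤s z≤n)) 4≤B))
              ▸ exactly (op (ℕ.≤-<-trans (m/n≤m _ 2) product<W)) )
          ▹≤ exactly (op (word fitting)) )
      ▹≤ exactly end-run )
      where
      open Leaf es rest C count fitting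

      m-1≤B : m ∸ 1 ≤ B
      m-1≤B = ℕ.≤-trans (ℕ.m∸n≤m m 1) m≤B

      product<W : (m ∸ 1) * (m ∸ 2) < W
      product<W = fits (ℕ.*-mono-≤ m-1≤B (ℕ.≤-trans (ℕ.m∸n≤m m 2) m≤B))

-- Certificates, index bounds and costs of decomposition trees

vertices : ∀ T → Vertex T ↔ Fin (vertexCount T)
vertices (treeLeaf _ _)   = ↔-refl
vertices (cotreeLeaf _ _) = ↔-refl
vertices (unionNode S T)  = ↔-trans (vertices S ⊎-↔ vertices T) (↔-sym Fin.+↔⊎)
vertices (joinNode S T)   = ↔-trans (vertices S ⊎-↔ vertices T) (↔-sym Fin.+↔⊎)

vertex-≟ : ∀ T → DecidableEquality (Vertex T)
vertex-≟ T = via-injection (↔⇒↣ (vertices T)) Fin._≟_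

certificate : ∀ {ws T} (e : ws Encodes T) → Certificate ⟦ T ⟧ (index e)
certificate (treeLeaf {G = G} {G-tree} listed) with edges , refl ← lift-edges G listed =
  ListedTree.tree-certificate G G-tree edges listed
certificate (cotreeLeaf {G = G} {G-tree} _) = cotree-certificate G G-tree
certificate (unionNode s t) = union-certificate _ _ (certificate s) (certificate t)
certificate (joinNode {S} {T} s t) =
  join-certificate _ _ (vertices S) (vertices T) (certificate s) (certificate t)

-- Needed to fit the indices into words. The square is inductive, as a join adds only half of the
-- cross term of (a + b)².
index-bound : ∀ {ws T} (e : ws Encodes T) → index e ≤ vertexCount T * vertexCount T
index-bound (treeLeaf {m} {G} {G-tree} {es} listed) with edges , refl ← lift-edges G listed = begin
  treeIndex es          ≤⟨ ListedTree.index-upper G G-tree edges listed ⟩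
  length es             ≤⟨ ℕ.n≤1+n _ ⟩
  suc (length es)       ≡⟨ count ⟩
  m                     ≤⟨ ℕ.m≤m*n m m {{subst NonZero count _}} ⟩
  m * m                 ∎
  where
  open ℕ.≤-Reasoning
  count = tree-edge-count G G-tree listed
index-bound (cotreeLeaf {m} _) =
  ℕ.≤-trans (m/n≤m _ 2) (ℕ.*-mono-≤ (ℕ.m∸n≤m m 1) (ℕ.m∸n≤m m 2))
index-bound (unionNode {S} {T} s t) = ℕ.⊔-lub
  (ℕ.≤-trans (index-bound s) (ℕ.*-mono-≤ (ℕ.m≤m+n a b) (ℕ.m≤m+n a b)))
  (ℕ.≤-trans (index-bound t) (ℕ.*-mono-≤ (ℕ.m≤n+m b a) (ℕ.m≤n+m b a)))
  where
  a = vertexCount S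
  b = vertexCount T
index-bound (joinNode {S} {T} s t) = begin
  index s + (index t + a * b)     ≤⟨ ℕ.+-mono-≤ (index-bound s) (ℕ.+-monoˡ-≤ (a * b) (index-bound t)) ⟩
  a * a + (b * b + a * b)         ≤⟨ ℕ.m≤m+n _ (a * b) ⟩
  a * a + (b * b + a * b) + a * b ≡⟨ solve 2 (λ a b → a :* a :+ (b :* b :+ a :* b) :+ a :* b := (a :+ b) :* (a :+ b)) refl a b ⟩
  (a + b) * (a + b)               ∎
  where
  open ℕ.≤-Reasoning
  open +-*-Solver
  a = vertexCount S
  b = vertexCount T

-- The 24 of an inner node are the 23 steps of `node` and the loop test.
cost : DecompositionTree → ℕ
cost (treeLeaf {m} _ _)   = m * 70
cost (cotreeLeaf {m} _ _) = m * 70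
cost (unionNode S T)      = cost S + (cost T + 24)
cost (joinNode S T)       = cost S + (cost T + 24)

vertexCount-positive : ∀ T → 0 < vertexCount T
vertexCount-positive (treeLeaf _ ((r , _) , _))   = ℕ.≤-trans (s≤s z≤n) (Fin.toℕ<n r)
vertexCount-positive (cotreeLeaf _ ((r , _) , _)) = ℕ.≤-trans (s≤s z≤n) (Fin.toℕ<n r)
vertexCount-positive (unionNode S T) = ℕ.≤-trans (vertexCount-positive S) (ℕ.m≤m+n _ _)
vertexCount-positive (joinNode S T)  = ℕ.≤-trans (vertexCount-positive S) (ℕ.m≤m+n _ _)

private
  leaf-cost : ∀ m → 0 < m → m * 70 + 24 ≤ m * 94
  leaf-cost m m>0 = begin
    m * 70 + 24     ≤⟨ ℕ.+-monoʳ-≤ (m * 70) (ℕ.m≤n*m 24 m {{>-nonZero m>0}}) ⟩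
    m * 70 + m * 24 ≡⟨ ℕ.*-distribˡ-+ m 70 24 ⟨
    m * 94          ∎
    where open ℕ.≤-Reasoning

  node-cost : ∀ c d a b → c + 24 ≤ a * 94 → d + 24 ≤ b * 94 → c + (d + 24) + 24 ≤ (a + b) * 94
  node-cost c d a b p q = begin
    c + (d + 24) + 24   ≡⟨ solve 2 (λ c d → c :+ (d :+ con 24) :+ con 24 := (c :+ con 24) :+ (d :+ con 24)) refl c d ⟩
    (c + 24) + (d + 24) ≤⟨ ℕ.+-mono-≤ p q ⟩
    a * 94 + b * 94     ≡⟨ ℕ.*-distribʳ-+ 94 a b ⟨
    (a + b) * 94        ∎
    where
    open ℕ.≤-Reasoning
    open +-*-Solver

-- Each leaf pays 24 in advance for an inner node. There is one leaf more than inner nodes, so 24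
-- remain throughout; hence 94 as 70 + 24.
cost-linear : ∀ T → cost T + 24 ≤ vertexCount T * 94
cost-linear T@(treeLeaf {m} _ _)   = leaf-cost m (vertexCount-positive T)
cost-linear T@(cotreeLeaf {m} _ _) = leaf-cost m (vertexCount-positive T)
cost-linear (unionNode S T) = node-cost (cost S) (cost T) (vertexCount S) (vertexCount T) (cost-linear S) (cost-linear T)
cost-linear (joinNode S T)  = node-cost (cost S) (cost T) (vertexCount S) (vertexCount T) (cost-linear S) (cost-linear T)

-- A leaf has 2m words, which leaves at least one to spare. Of the two spare words of its children,
-- a node spends one on its tag and keeps the other.
input-length : ∀ {ws T} → ws Encodes T → suc (length ws) ≤ 3 * vertexCount T
input-length e = go e
  where
  open ℕ.≤-Reasoning
  open +-*-Solver
  leaf : ∀ {m} (es : List (Fin m × Fin m)) → suc (length es) ≡ m → 3 + length (edgeWords es) ≤ 3 * m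
  leaf {m} es count = begin
    3 + length (edgeWords es)      ≡⟨ cong (3 +_) (length-edgeWords es) ⟩
    3 + (length es + length es)    ≤⟨ ℕ.m≤m+n _ (length es) ⟩
    3 + (length es + length es) + length es ≡⟨ solve 1 (λ e → con 3 :+ (e :+ e) :+ e := con 3 :* (con 1 :+ e)) refl (length es) ⟩
    3 * suc (length es)            ≡⟨ cong (3 *_) count ⟩
    3 * m                          ∎

  node : ∀ a b {w} (ss ts : List ℕ) → suc (length ss) ≤ 3 * a → suc (length ts) ≤ 3 * b →
         suc (length (ss ++ ts ++ w ∷ [])) ≤ 3 * (a + b)
  node a b {w} ss ts p q = begin
    suc (length (ss ++ ts ++ w ∷ []))       ≡⟨ cong suc (length-++ ss) ⟩
    suc (length ss + length (ts ++ w ∷ [])) ≡⟨ cong (λ l → suc (length ss + l)) (trans (length-++ ts) (ℕ.+-comm (length ts) 1)) ⟩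
    suc (length ss) + suc (length ts)       ≤⟨ ℕ.+-mono-≤ p q ⟩
    3 * a + 3 * b                           ≡⟨ ℕ.*-distribˡ-+ 3 a b ⟨
    3 * (a + b)                             ∎

  go : ∀ {ws T} → ws Encodes T → suc (length ws) ≤ 3 * vertexCount T
  go (treeLeaf {G = G} {G-tree} {es} listed)   = leaf es (tree-edge-count G G-tree listed)
  go (cotreeLeaf {G = G} {G-tree} {es} listed) = leaf es (tree-edge-count G G-tree listed)
  go (unionNode {S} {T} {ss} {ts} s t) = node (vertexCount S) (vertexCount T) ss ts (go s) (go t)
  go (joinNode {S} {T} {ss} {ts} s t)  = node (vertexCount S) (vertexCount T) ss ts (go s) (go t)

-- Evaluation of whole encodings

module Evaluation (W B L : ℕ) (4≤B : 4 ≤ B) (fits : ∀ {x} → x ≤ B * B → x < W) where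
  open Simulation W B L 4≤B fits
  open Config using (state; D)

  -- A run of a loop is nested to the right, so finitely many iterations are expressed by what they
  -- prepend to any run of the remaining loop.
  Reaches : ℕ → State 12 → State 12 → Set
  Reaches b s s′ = ∀ {c s″} → W ⊢ whileNonzero todo step ∶ s′ ⇓≤[ c ] s″ →
                   W ⊢ whileNonzero todo step ∶ s ⇓≤[ b + c ] s″

  once : ∀ {R M s′ b} → Vec.lookup R todo ≢ 0 → W ⊢ step ∶ ⟨ R , M ⟩ ⇓≤[ b ] s′ → Reaches (suc b) ⟨ R , M ⟩ s′
  once todo≢0 (_ , t≤ , p) (_ , u≤ , q) = _ , s≤s (ℕ.+-mono-≤ t≤ u≤) , while-nonzero todo≢0 p q

  infixr 5 _then_
  _then_ : ∀ {a b s s′ s″} → Reaches a s s′ → Reaches b s′ s″ → Reaches (a + b) s s″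
  _then_ {a} {b} f g {c} r = relax (ℕ.≤-reflexive (sym (ℕ.+-assoc a b c))) (f (g r))

  evaluate-leaf : ∀ {st st′ input rest m} (C : Config st input) → 0 < m → length input ≢ 0 →
    (Σ (Config st′ rest) λ C′ → D C′ ≡ D C + m × (W ⊢ step ∶ state C ⇓≤[ m * 70 ∸ 1 ] state C′)) →
    Σ (Config st′ rest) λ C′ → D C′ ≡ D C + m × Reaches (m * 70) (state C) (state C′)
  evaluate-leaf {m = m} C m>0 nonempty (C′ , D≡ , run) =
    C′ , D≡ , subst (λ b → Reaches b (state C) (state C′))
      (ℕ.suc-pred (m * 70) {{>-nonZero (ℕ.≤-trans m>0 (ℕ.m≤m*n m 70))}}) (once nonempty run)

  -- Arbitrary `rest` and `st` make the statement apply to subtrees: the net effect is one pushed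
  -- pair and a shift of `D`. The equation for `input` absorbs the reassociation of `++`.
  evaluate : ∀ {ws T st rest input} (e : ws Encodes T) → input ≡ ws ++ rest →
             (C : Config st input) → D C + vertexCount T ≤ B →
             Σ (Config ((vertexCount T , index e) ∷ st) rest) λ C′ → D C′ ≡ D C + vertexCount T ×
               Reaches (cost T) (state C) (state C′)

  evaluate-node : ∀ {S T ss ts st rest input w f} (s : ss Encodes S) (t : ts Encodes T) →
    input ≡ (ss ++ ts ++ 2 + w ∷ []) ++ rest →
    (C : Config st input) → D C + (vertexCount S + vertexCount T) ≤ B → 2 + w ≤ B →
    (∀ {p k D r t′ M} → ∃[ u ] ∃[ v ] (W ⊢ ifNonzero aux combineJoin combineUnion ∶
        ⟨ regs L p k D r t′ (vertexCount S) (index s) (vertexCount T) (index t) w , M ⟩ ⇓≤[ 4 ]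
        ⟨ regs L p k D r t′ (vertexCount S) f (vertexCount T) u v , M ⟩)) →
    Σ (Config ((vertexCount S + vertexCount T , f) ∷ st) rest) λ C′ → D C′ ≡ D C + (vertexCount S + vertexCount T) ×
      Reaches (cost S + (cost T + 24)) (state C) (state C′)

  evaluate {rest = rest} (treeLeaf {m} {G} {G-tree} {es} listed) refl C fitting
    = evaluate-leaf C (vertexCount-positive (treeLeaf G G-tree)) (λ ())
        (tree-leaf es rest C (tree-edge-count G G-tree listed) fitting)
  evaluate {rest = rest} (cotreeLeaf {m} {G} {G-tree} {es} listed) refl C fitting
    = evaluate-leaf C (vertexCount-positive (cotreeLeaf G G-tree)) (λ ())
        (cotree-leaf es rest C (tree-edge-count G G-tree listed) fitting)
  evaluate (unionNode s t) eq C fitting =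
    evaluate-node s t eq C fitting (ℕ.≤-trans (s≤s (s≤s z≤n)) 4≤B)
      (_ , _ , relax (ℕ.n≤1+n 3) (if-zero≤ refl
        (op (ℕ.≤-<-trans (ℕ.m∸n≤m _ (index s)) (≤square (ℕ.m≤n⊔m (index s) (index t))))
        ▸ exactly (op′ (m+[n∸m]≡m⊔n (index s) (index t)) (≤square ℕ.≤-refl)))))
    where
    ≤square : ∀ {x} → x ≤ index s ⊔ index t → x < W
    ≤square x≤ = fits (ℕ.≤-trans x≤ (ℕ.≤-trans (index-bound (unionNode s t)) (ℕ.*-mono-≤ below below)))
      where below = ℕ.≤-trans (ℕ.m≤n+m _ (D C)) fitting
  evaluate (joinNode {S} {T} s t) eq C fitting =
    evaluate-node s t eq C fitting (ℕ.≤-trans (s≤s (s≤s (s≤s z≤n))) 4≤B)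
      (_ , _ , if-nonzero≤ (λ ())
        (op (≤square (ℕ.≤-trans (ℕ.m≤n+m _ (index t)) (ℕ.m≤n+m _ (index s))))
        ▸ op (≤square (ℕ.m≤n+m _ (index s)))
        ▸ exactly (op (≤square ℕ.≤-refl))))
    where
    ≤square : ∀ {x} → x ≤ index s + (index t + vertexCount S * vertexCount T) → x < W
    ≤square x≤ = fits (ℕ.≤-trans x≤ (ℕ.≤-trans (index-bound (joinNode s t)) (ℕ.*-mono-≤ below below)))
      where below = ℕ.≤-trans (ℕ.m≤n+m _ (D C)) fitting

  evaluate-node {S} {T} {ss} {ts} {rest = rest} {w = w} s t eq C fitting w≤B combine =
    let C₁ , D₁ , run₁ = evaluate s eq′ C (ℕ.≤-trans (ℕ.+-monoʳ-≤ (D C) (ℕ.m≤m+n a b)) fitting)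
        D₁+b = trans (cong (_+ b) D₁) (ℕ.+-assoc (D C) a b)
        C₂ , D₂ , run₂ = evaluate t refl C₁ (subst (_≤ B) (sym D₁+b) fitting)
        D₂′ = trans D₂ D₁+b
        C₃ , D₃ , run₃ = node C₂ w≤B (subst (_≤ B) (sym D₂′) fitting) a+b≤B
                           (square (index-bound s) (ℕ.m≤m+n a b)) (square (index-bound t) (ℕ.m≤n+m b a)) combine
    in C₃ , trans D₃ D₂′ , run₁ then run₂ then once (λ ()) run₃
    where
    a = vertexCount S
    b = vertexCount T

    eq′ : _ ≡ ss ++ ts ++ 2 + w ∷ rest
    eq′ = trans eq (trans (++-assoc ss (ts ++ 2 + w ∷ []) rest) (cong (ss ++_) (++-assoc ts (2 + w ∷ []) rest)))

    a+b≤B : a + b ≤ B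
    a+b≤B = ℕ.≤-trans (ℕ.m≤n+m _ (D C)) fitting

    square : ∀ {x c} → x ≤ c * c → c ≤ a + b → x < W
    square x≤ c≤ = fits (ℕ.≤-trans x≤ (ℕ.*-mono-≤ (ℕ.≤-trans c≤ a+b≤B) (ℕ.≤-trans c≤ a+b≤B)))

holds-contents : ∀ {M p} ws → (∀ i → M (p + i) ≡ contents ws i) → Holds M p ws
holds-contents [] _ = []
holds-contents {M} {p} (w ∷ ws) eq =
  trans (cong M (sym (ℕ.+-identityʳ p))) (eq 0) ∷
  holds-contents ws (λ i → trans (cong M (sym (ℕ.+-suc p i))) (eq (suc i)))

contents-beyond : ∀ ws i → length ws ≤ i → contents ws i ≡ 0
contents-beyond []       i       _        = refl
contents-beyond (w ∷ ws) (suc i) (s≤s le) = contents-beyond ws i le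

result : ∀ {M k n s} → Stack M k ((n , s) ∷ []) → M 1 ≡ s
result (push empty _ s≡) = s≡

-- Word size and running time of the program

module _ {n} (T : DecompositionTree) (n≡ : n ≡ vertexCount T) (ws : List ℕ) (e : ws Encodes T) where
  private
    -- `B` covers at most 3n cells of input and n degree counters. The exponent 6 is twice 3, as 4(n
    -- + 1) is at most the cube of n + 1 for positive n.
    W = suc n ^ 6
    B = 4 * n
    L = length ws

    n>0 : 0 < n
    n>0 = subst (0 <_) (sym n≡) (vertexCount-positive T)

    L≤3n : L ≤ 3 * n
    L≤3n = ℕ.≤-trans (ℕ.n≤1+n L) (subst (λ k → suc L ≤ 3 * k) (sym n≡) (input-length e))

    4≤B : 4 ≤ B
    4≤B = ℕ.*-monoʳ-≤ 4 n>0

    square<W : B * B < W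
    square<W = begin-strict
      4 * n * (4 * n)         <⟨ ℕ.*-mono-< 4n<4+4n 4n<4+4n ⟩
      4 * suc n * (4 * suc n) ≤⟨ ℕ.*-mono-≤ 4+4n≤cube 4+4n≤cube ⟩
      suc n ^ 3 * suc n ^ 3   ≡⟨ ℕ.^-distribˡ-+-* (suc n) 3 3 ⟨
      suc n ^ 6               ∎
      where
      open ℕ.≤-Reasoning
      4n<4+4n : 4 * n < 4 * suc n
      4n<4+4n = ℕ.*-monoʳ-< 4 (ℕ.n<1+n n)

      4+4n≤cube : 4 * suc n ≤ suc n ^ 3
      4+4n≤cube = begin
        4 * suc n             ≤⟨ ℕ.*-monoˡ-≤ (suc n) (ℕ.*-mono-≤ (s≤s n>0) (s≤s n>0)) ⟩
        suc n * suc n * suc n ≡⟨ ℕ.*-assoc (suc n) (suc n) (suc n) ⟩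
        suc n * (suc n * suc n) ≡⟨ cong (λ k → suc n * (suc n * k)) (ℕ.*-identityʳ (suc n)) ⟨
        suc n ^ 3             ∎

    fits : ∀ {x} → x ≤ B * B → x < W
    fits x≤ = ℕ.≤-<-trans x≤ square<W

    open Simulation W B L 4≤B fits
    open Evaluation W B L 4≤B fits

    start : Config [] ws
    start = record
      { p = 0 ; k = 0 ; D = L ; t = 0 ; n = 0 ; s = 0 ; c = 0 ; u = 0 ; v = 0
      ; M = contents ws ; stack = empty ; unread = holds-contents ws (λ _ → refl)
      ; k≤p = z≤n ; end = refl ; L≤D = ℕ.≤-refl ; zeros = contents-beyond ws }

    L≤B : L ≤ B
    L≤B = ℕ.≤-trans L≤3n (ℕ.m≤n+m (3 * n) n)

    L+n≤B : L + vertexCount T ≤ B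
    L+n≤B = begin
      L + vertexCount T ≡⟨ cong (L +_) n≡ ⟨
      L + n             ≤⟨ ℕ.+-monoˡ-≤ n L≤3n ⟩
      3 * n + n         ≡⟨ ℕ.+-comm (3 * n) n ⟩
      4 * n             ∎
      where open ℕ.≤-Reasoning

    index<W : index e < W
    index<W = fits (ℕ.≤-trans (index-bound e) (ℕ.*-mono-≤ below below))
      where
      below : vertexCount T ≤ B
      below = ℕ.≤-trans (ℕ.m≤n+m _ L) L+n≤B

    -- Three initial assignments, the last loop test and the final load fit into the 24 steps that
    -- `cost-linear` leaves over.
    time : 3 + (cost T + 1 + 1) ≤ 100 * n
    time = begin
      3 + (cost T + 1 + 1) ≡⟨ solve 1 (λ c → con 3 :+ (c :+ con 1 :+ con 1) := c :+ con 5) refl (cost T) ⟩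
      cost T + 5           ≤⟨ ℕ.+-monoʳ-≤ (cost T) (ℕ.m≤m+n 5 19) ⟩
      cost T + 24          ≤⟨ cost-linear T ⟩
      vertexCount T * 94   ≡⟨ cong (_* 94) n≡ ⟨
      n * 94               ≤⟨ ℕ.*-monoʳ-≤ n (ℕ.m≤m+n 94 6) ⟩
      n * 100              ≡⟨ ℕ.*-comm n 100 ⟩
      100 * n              ∎
      where
      open ℕ.≤-Reasoning
      open +-*-Solver

  main-correct : ∃[ t ] ∃[ s ] (W ⊢ main ∶ initial ws ⇓[ t ] s) × (t ≤ 100 * n) × output s ≡ index e
  main-correct =
    let C , _ , run = evaluate e (sym (++-identityʳ ws)) start L+n≤B
        t , t≤ , whole =
            exactly ( op′ (ℕ.+-identityʳ L) (word L≤B) ▹ op′ (ℕ.+-identityʳ L) (word L≤B)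
                    ▹ const (word (ℕ.≤-trans (s≤s z≤n) 4≤B)) )
          ▹≤ run (exactly (while-zero refl)) ▹≤ exactly (load′ (result (Config.stack C)) index<W)
    in t , _ , whole , ℕ.≤-trans t≤ time , refl

theorem4 : ∃[ r ] Σ (Program (suc r)) λ P → ∃[ c ] ∃[ d ]
    (∀ {n} (G : Graph (Fin n)) → TreeCograph G →
    (T : DecompositionTree) → T IsDecompositionOf G →
    (ws : List ℕ) → ws Encodes T →
    ∃[ t ] ∃[ s ]
    ((suc n ^ d) ⊢ P ∶ initial ws ⇓[ t ] s) ×
    (t ≤ c * n) ×
    IsStrongChromaticIndex G (output s))
theorem4 = 11 , main , 100 , 6 , λ G _ T iso ws e →
  let t , s , run , fast , correct = main-correct T (↔⇒≡ (↔-trans (_≅_.bijection iso) (vertices T))) ws e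
  in t , s , run , fast ,
     subst (IsStrongChromaticIndex G) (sym correct)
       (index-respects-≅ iso (certificate⇒index ⟦ T ⟧ (vertex-≟ T) (certificate e)))
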